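{- Let $c,k$ be positive integers with $k$ odd, let $d,z$ be nonnegative integers, let $\zeta_{2c}$ be a primitive $2c$-th root of unity and $P\in\mathbb{Z}[\zeta_{2c}][x]$. If $n\ge(\deg(P)+2d+1)kc$, then $$\sum_{m=0}^n \zeta_{2c}^m P(m)\,q^{zm}\binom{n}{m}_q\equiv 0\pmod{\Phi_{kc}(q)^{d+1}}$$ in $\mathbb{Z}[\zeta_{2c}][q]$.
   Context: $\binom{n}{m}_q=\frac{(1-q^n)\cdots(1-q^{n-m+1})}{(1-q^m)\cdots(1-q)}$ is the $q$-binomial coefficient, and $\Phi_N(q)$ is the $N$-th cyclotomic polynomial. -}

module Defs where

open import Data.Nat as ℕ using (ℕ; zero; suc; _∸_)
open import Data.Nat.Divisibility using (_∣?_)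
open import Data.Integer as ℤ using (ℤ; +_)
open import Data.List using (List; []; _∷_; map; reverse; length; filter; upTo; foldr)
open import Data.Unit using (⊤)
open import Data.Product using (_×_)
open import Relation.Binary.PropositionalEquality using (_≡_)

-- A minimal interface for coefficient rings of polynomial rings.
-- IsZ x expresses "x is zero" (equality in the ring is x ≈ y := IsZ (x - y)).

record Coeffs : Set₁ where
  field
    C    : Set
    0c   : C
    1c   : C
    _+c_ : C → C → C
    _*c_ : C → C → C
    -c_  : C → C
    IsZ  : C → Set

-- Univariate polynomials over a coefficient ring: coefficient lists,
-- lowest degree first.  Trailing zeros are allowed; equality ignores them.

module Poly (R : Coeffs) where
  open Coeffs R

  Pol : Set
  Pol = List C

  infixl 6 _⊕_
  infixl 7 _⊗_

  _⊕_ : Pol → Pol → Pol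
  []      ⊕ q       = q
  (a ∷ p) ⊕ []      = a ∷ p
  (a ∷ p) ⊕ (b ∷ q) = (a +c b) ∷ (p ⊕ q)

  scale : C → Pol → Pol
  scale a = map (a *c_)

  _⊗_ : Pol → Pol → Pol
  []      ⊗ q = []
  (a ∷ p) ⊗ q = scale a q ⊕ (0c ∷ (p ⊗ q))

  ⊖_ : Pol → Pol
  ⊖_ = map -c_

  const : C → Pol
  const a = a ∷ []

  one : Pol
  one = const 1c

  X : Pol
  X = 0c ∷ 1c ∷ []

  _^P_ : Pol → ℕ → Pol
  p ^P zero  = one
  p ^P suc n = p ⊗ (p ^P n)

  sumP : List Pol → Pol
  sumP = foldr _⊕_ []

  prodP : List Pol → Pol
  prodP = foldr _⊗_ one

  IsZeroP : Pol → Set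
  IsZeroP []      = ⊤
  IsZeroP (a ∷ p) = IsZ a × IsZeroP p

  infix 4 _≈P_
  _≈P_ : Pol → Pol → Set
  p ≈P q = IsZeroP (p ⊕ (⊖ q))

  PolCoeffs : Coeffs
  PolCoeffs = record
    { C = Pol ; 0c = [] ; 1c = one ; _+c_ = _⊕_ ; _*c_ = _⊗_
    ; -c_ = ⊖_ ; IsZ = IsZeroP }

-- ℤ, ℤ[t], ℤ[ζ][q] (the latter realised as ℤ[ζ,q], reduced mod Φ_{2c}(ζ)
-- in the statement).

ℤCoeffs : Coeffs
ℤCoeffs = record
  { C = ℤ ; 0c = + 0 ; 1c = + 1 ; _+c_ = ℤ._+_ ; _*c_ = ℤ._*_
  ; -c_ = ℤ.-_ ; IsZ = λ x → x ≡ + 0 }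

module Z = Poly ℤCoeffs          -- ℤ[t] (t = q or t = ζ depending on use)

ℤζCoeffs : Coeffs
ℤζCoeffs = Z.PolCoeffs

module B = Poly ℤζCoeffs         -- ℤ[ζ][t]  (outer variable t = q or x)

-- Exact division by a monic polynomial in ℤ[t] (synthetic long division).
-- Works on coefficient lists highest-degree first.

private
  subScaled : ℤ → List ℤ → List ℤ → List ℤ
  subScaled a []       r       = r
  subScaled a (g ∷ gs) []      = ℤ.- (a ℤ.* g) ∷ subScaled a gs []
  subScaled a (g ∷ gs) (x ∷ r) = (x ℤ.- a ℤ.* g) ∷ subScaled a gs r

  divHF : ℕ → List ℤ → List ℤ → List ℤ
  divHF zero    r       gs = []
  divHF (suc f) []      gs = []
  divHF (suc f) (a ∷ r) gs = a ∷ divHF f (subScaled a gs r) gs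

-- quotient of p by a monic g whose leading coefficient is its last entry
-- (p, g without trailing zeros)
divMonic : List ℤ → List ℤ → List ℤ
divMonic p g with reverse g
... | []       = []
... | _ ∷ gs   = reverse (divHF (suc (length p ∸ length g)) (reverse p) gs)

properDivisors : ℕ → List ℕ
properDivisors N = filter (λ d → d ∣? N) (Data.List.drop 1 (upTo N))
  where import Data.List

tPowMinus1 : ℕ → Z.Pol
tPowMinus1 N = (Z.X Z.^P N) Z.⊕ Z.const (ℤ.- (+ 1))

cycF : ℕ → ℕ → Z.Pol
cycF zero    N = Z.one
cycF (suc f) N = divMonic (tPowMinus1 N) (Z.prodP (map (cycF f) (properDivisors N)))

-- Φ_N(t) ∈ ℤ[t] (meaningful for N ≥ 1)
Φ : ℕ → Z.Pol
Φ N = cycF N N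

-- Gaussian (q-)binomial coefficients in ℤ[q], via the q-Pascal rule
--   [n,0] = 1, [0,m+1] = 0, [n+1,m+1] = [n,m] + q^{m+1} [n,m+1],
-- which for m ≤ n equals (1-q^n)⋯(1-q^{n-m+1}) / ((1-q^m)⋯(1-q)).

qbinom : ℕ → ℕ → Z.Pol
qbinom n       zero    = Z.one
qbinom zero    (suc m) = []
qbinom (suc n) (suc m) = qbinom n m Z.⊕ ((Z.X Z.^P suc m) Z.⊗ qbinom n (suc m))

liftQ : Z.Pol → B.Pol
liftQ = map Z.const

liftζ : Z.Pol → B.Pol
liftζ = B.const

ζ : Z.Pol
ζ = Z.X

-- Polynomials P ∈ ℤ[ζ][x] are represented by B.Pol (coefficients of
-- x^0, x^1, … in ℤ[ζ]).  Evaluation at a natural number m (Horner):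

evalAt : B.Pol → ℕ → Z.Pol
evalAt []      m = []
evalAt (a ∷ p) m = a Z.⊕ (Z.const (+ m) Z.⊗ evalAt p m)

-- degree bound of a representative: length − 1 (0 for the empty list)
degBound : B.Pol → ℕ
degBound P = length P ∸ 1

theSum : ℕ → B.Pol → ℕ → B.Pol
theSum z P n = B.sumP (map term (upTo (suc n)))
  where
    term : ℕ → B.Pol
    term m = liftζ ((ζ Z.^P m) Z.⊗ evalAt P m)
             B.⊗ liftQ ((Z.X Z.^P (z ℕ.* m)) Z.⊗ qbinom n m)

-- Congruence  S ≡ T (mod M)  in ℤ[ζ_{2c}][q] = ℤ[ζ][q]/(Φ_{2c}(ζ)):
-- S − T = M·Q + Φ_{2c}(ζ)·R  in ℤ[ζ][q] for some Q, R.
CongMod : ℕ → B.Pol → B.Pol → B.Pol → Set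
CongMod c M S T =
  Σ B.Pol λ Q → Σ B.Pol λ R →
    S B.⊕ (B.⊖ T) B.≈P M B.⊗ Q B.⊕ liftζ (Φ (2 ℕ.* c)) B.⊗ R
  where open import Data.Product using (Σ)

zeroB : B.Pol
zeroB = []

{-# OPTIONS --safe #-}
module Submission where

-- Write N = kc, φ = Φ_N(q), and work in ℤ[ζ][q] modulo Φ_{2c}(ζ).  By the q-Pascal rule the sum is
-- (Tⁿ h)(0), where h(m) = q^{zm} P(m) and (T h)(m) = ζ h(m+1) + q^m h(m).  The q-binomial theorem,
-- together with φ ∣ [N, j] for 0 < j < N and ζ^N = -1, gives
--   (T^N h)(m) = (q^{Nm} - 1) h(m) - (h(m+N) - h(m)) + φ (...).
-- Give both m and G(m) = (q^{Nm} - 1)/φ degree 1 and q^m degree 0.  Modulo φ times degree a + 1, the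
-- operator T^N then lowers degree a to a - 1, so that φ counts for two degrees; after deg P + 2d + 1
-- applications of T^N only multiples of φ^{d+1} are left.  (In an abstract ring ζ is written ω.)
--
-- The facts about cyclotomic polynomials follow from one statement: for 0 < m < N, Φ_N ∣ (t^m - 1) f
-- implies Φ_N ∣ f.

open import Defs
open import Algebra.Bundles using (AbelianGroup; CommutativeRing; RawRing)
open import Algebra.Morphism.Structures using (IsRingHomomorphism)
import Algebra.Properties.CommutativeSemiring.Exp as Exp
import Algebra.Properties.Semigroup.Divisibility as SemigroupDivisibility
import Algebra.Solver.Ring
import Algebra.Solver.Ring.AlmostCommutativeRing as ACR
open import Algebra.Structures using (IsCommutativeRing)
open import Data.Integer.Base as ℤ using (ℤ; +_)
import Data.Integer.Properties as ℤₚ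
open import Data.List.Base using (List; []; _∷_; _++_; _∷ʳ_; applyUpTo; foldr; length; map; reverse)
open import Data.List.Membership.Propositional using (_∈_)
open import Data.List.Membership.Propositional.Properties
  using (∈-++⁻; ∈-applyUpTo⁺; ∈-applyUpTo⁻; ∈-filter⁺; ∈-filter⁻; ∈-map⁺)
import Data.List.Properties as Listₚ
open import Data.List.Relation.Unary.All as All using (All; []; _∷_)
import Data.List.Relation.Unary.All.Properties as Allₚ
open import Data.List.Relation.Unary.AllPairs using (AllPairs; []; _∷_)
import Data.List.Relation.Unary.AllPairs.Properties as AllPairsₚ
open import Data.List.Relation.Unary.Any using (here; there)
open import Data.Maybe.Base using (just; nothing)
open import Data.Nat using (ℕ; zero; suc; _∸_; _≤_; _<_; _%_; z≤n; s≤s; >-nonZero)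
import Data.Nat as ℕ
open import Data.Nat.Divisibility as ℕ∣ using (_∣?_) renaming (_∣_ to _∣ℕ_)
open import Data.Nat.GCD using (gcd; gcd-GCD; gcd[m,n]∣m; gcd[m,n]∣n; gcd[m,n]≡0⇒m≡0; module Bézout)
open import Data.Nat.Induction using (<-rec)
import Data.Nat.Properties as ℕₚ
open import Data.Nat.Tactic.RingSolver using (solve-∀)
open import Data.Product.Base using (∃; ∃₂; _×_; _,_; proj₁; proj₂)
open import Data.Sum.Base using (inj₁; inj₂)
open import Data.Unit.Base using (tt)
open import Function.Base using (_∘_)
open import Level using (0ℓ; _⊔_)
open import Relation.Binary.Bundles using (Setoid)
open import Relation.Binary.Core using (Rel)
open import Relation.Binary.Definitions using (WeaklyDecidable)
import Relation.Binary.PropositionalEquality as ≡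
open import Relation.Binary.PropositionalEquality using (_≡_)
open import Relation.Nullary using (yes; no)
open import Relation.Nullary.Negation.Core using (contradiction)

-- The oddness of k enters through ζ^N = (ζ^c)^k = -1. This sign turns the two extreme terms of the
-- q-binomial expansion into a difference, and it is a difference that lowers degrees. The length of
-- the sum is the price of `G`: the term φ G h gains a power of φ but also a degree, so a sequence
-- of degree a that still lacks e ≥ 1 powers of φ costs a + 2e - 1 blocks of N steps, and e = d + 1
-- at the start.
--
-- No cancellation of φ is established in ℤ[ζ][q] modulo Φ_{2c}(ζ). Each quotient by φ is therefore
-- an explicit element: `γ` for q^N - 1, `β` for the Gaussian binomials, and `G`, built by recursion
-- on m. In ℤ[t], Φ_N is given only as the output of a list division, so divisibility is argued
-- through monic division and the vanishing of remainders.

-- An equation solver with integer coefficients for any commutative ring.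

module CommutativeRingSolver {c ℓ} (R : CommutativeRing c ℓ) where
  open CommutativeRing R hiding (zero)
  open import Algebra.Properties.Semiring.Mult semiring using (×-homo-+; ×1-homo-*) renaming (_×_ to _·_)
  open import Relation.Binary.Reasoning.Setoid setoid
  open import Algebra.Properties.Ring ring using (x[y-z]≈xy-xz; [y-z]x≈yx-zx)
  open import Algebra.Properties.AbelianGroup +-abelianGroup using (⁻¹-∙-comm; ⁻¹-anti-homo-//)
  open import Algebra.Properties.CommutativeSemigroup +-commutativeSemigroup using (interchange)

  [x+z]-[y+w] : ∀ x y z w → (x + z) - (y + w) ≈ (x - y) + (z - w)
  [x+z]-[y+w] x y z w = trans (+-congˡ (sym (⁻¹-∙-comm y w))) (interchange x z (- y) (- w))

  [x-y][z-w] : ∀ x y z w → (x * z + y * w) - (x * w + y * z) ≈ (x - y) * (z - w)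
  [x-y][z-w] x y z w = begin
    (x * z + y * w) - (x * w + y * z)      ≈⟨ [x+z]-[y+w] _ _ _ _ ⟩
    (x * z - x * w) + (y * w - y * z)      ≈⟨ +-congˡ (⁻¹-anti-homo-// _ _) ⟨
    (x * z - x * w) - (y * z - y * w)      ≈⟨ +-cong (x[y-z]≈xy-xz x z w) (-‿cong (x[y-z]≈xy-xz y z w)) ⟨
    x * (z - w) - y * (z - w)              ≈⟨ [y-z]x≈yx-zx (z - w) x y ⟨
    (x - y) * (z - w)                      ∎

  reduce : ℕ × ℕ → ℕ × ℕ
  reduce (suc a , suc b) = reduce (a , b)
  reduce p = p

  -- (a , b) stands for the integer a - b; reduced pairs make the solver's normal forms canonical.
  ℕ² : RawRing _ _
  ℕ² = record
    { Carrier = ℕ × ℕ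
    ; _≈_ = _≡_
    ; _+_ = λ (a , b) (c , d) → reduce (a ℕ.+ c , b ℕ.+ d)
    ; _*_ = λ (a , b) (c , d) → reduce (a ℕ.* c ℕ.+ b ℕ.* d , a ℕ.* d ℕ.+ b ℕ.* c)
    ; -_ = λ (a , b) → b , a
    ; 0# = 0 , 0
    ; 1# = 1 , 0
    }
  private module P = RawRing ℕ²

  diff : ℕ × ℕ → Carrier
  diff (a , b) = a · 1# - b · 1#

  -- Agrees with `diff`, but sends the literals 0 and 1 to 0# and 1# on the nose.
  ⟦_⟧ : ℕ × ℕ → Carrier
  ⟦ 0 , 0 ⟧ = 0#
  ⟦ 1 , 0 ⟧ = 1#
  ⟦ p ⟧ = diff p

  ⟦⟧≈diff : ∀ p → ⟦ p ⟧ ≈ diff p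
  ⟦⟧≈diff (0 , 0) = sym (-‿inverseʳ 0#)
  ⟦⟧≈diff (1 , 0) = sym (trans (+-congʳ (+-identityʳ 1#)) (trans (+-congˡ ε⁻¹≈ε) (+-identityʳ 1#)))
    where open import Algebra.Properties.Group +-group using (ε⁻¹≈ε)
  ⟦⟧≈diff (0 , suc _) = refl
  ⟦⟧≈diff (1 , suc _) = refl
  ⟦⟧≈diff (suc (suc _) , _) = refl

  diff-reduce : ∀ p → diff (reduce p) ≈ diff p
  diff-reduce (zero , b) = refl
  diff-reduce (suc a , zero) = refl
  diff-reduce (suc a , suc b) = trans (diff-reduce (a , b)) (sym (begin
    (1# + a · 1#) - (1# + b · 1#)   ≈⟨ [x+z]-[y+w] 1# 1# (a · 1#) (b · 1#) ⟩
    (1# - 1#) + diff (a , b)        ≈⟨ +-congʳ (-‿inverseʳ 1#) ⟩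
    0# + diff (a , b)               ≈⟨ +-identityˡ _ ⟩
    diff (a , b)                    ∎))

  diff-+ : ∀ p r → diff (p P.+ r) ≈ diff p + diff r
  diff-+ (a , b) (c , d) = begin
    diff (reduce (a ℕ.+ c , b ℕ.+ d))
      ≈⟨ diff-reduce (a ℕ.+ c , b ℕ.+ d) ⟩
    (a ℕ.+ c) · 1# - (b ℕ.+ d) · 1#
      ≈⟨ +-cong (×-homo-+ 1# a c) (-‿cong (×-homo-+ 1# b d)) ⟩
    (a · 1# + c · 1#) - (b · 1# + d · 1#)
      ≈⟨ [x+z]-[y+w] (a · 1#) (b · 1#) (c · 1#) (d · 1#) ⟩
    diff (a , b) + diff (c , d) ∎

  diff-* : ∀ p r → diff (p P.* r) ≈ diff p * diff r
  diff-* (a , b) (c , d) = begin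
    diff (reduce (a ℕ.* c ℕ.+ b ℕ.* d , a ℕ.* d ℕ.+ b ℕ.* c))
      ≈⟨ diff-reduce (a ℕ.* c ℕ.+ b ℕ.* d , a ℕ.* d ℕ.+ b ℕ.* c) ⟩
    (a ℕ.* c ℕ.+ b ℕ.* d) · 1# - (a ℕ.* d ℕ.+ b ℕ.* c) · 1#
      ≈⟨ +-cong (two a c b d) (-‿cong (two a d b c)) ⟩
    (a · 1# * (c · 1#) + b · 1# * (d · 1#)) - (a · 1# * (d · 1#) + b · 1# * (c · 1#))
      ≈⟨ [x-y][z-w] (a · 1#) (b · 1#) (c · 1#) (d · 1#) ⟩
    diff (a , b) * diff (c , d) ∎
    where
    two : ∀ a c b d → (a ℕ.* c ℕ.+ b ℕ.* d) · 1# ≈ a · 1# * (c · 1#) + b · 1# * (d · 1#)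
    two a c b d = trans (×-homo-+ 1# (a ℕ.* c) (b ℕ.* d)) (+-cong (×1-homo-* a c) (×1-homo-* b d))

  homomorphism : ℕ² ACR.-Raw-AlmostCommutative⟶ ACR.fromCommutativeRing R
  homomorphism = record
    { ⟦_⟧ = ⟦_⟧
    ; +-homo = λ p r → trans (⟦⟧≈diff (p P.+ r)) (trans (diff-+ p r) (sym (+-cong (⟦⟧≈diff p) (⟦⟧≈diff r))))
    ; *-homo = λ p r → trans (⟦⟧≈diff (p P.* r)) (trans (diff-* p r) (sym (*-cong (⟦⟧≈diff p) (⟦⟧≈diff r))))
    ; -‿homo = λ p@(a , b) → trans (⟦⟧≈diff (b , a))
        (trans (sym (⁻¹-anti-homo-// (a · 1#) (b · 1#))) (sym (-‿cong (⟦⟧≈diff p))))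
    ; 0-homo = refl
    ; 1-homo = refl
    }

  _≟_ : WeaklyDecidable (ACR.Induced-equivalence homomorphism)
  (a , b) ≟ (c , d) with a ℕₚ.≟ c | b ℕₚ.≟ d
  ... | yes ≡.refl | yes ≡.refl = just refl
  ... | _          | _          = nothing

  open Algebra.Solver.Ring ℕ² (ACR.fromCommutativeRing R) homomorphism _≟_ public
    using (Polynomial; solve; _:=_; _:+_; _:*_; _:-_; :-_; con)

  :0 :1 : ∀ {n} → Polynomial n
  :0 = con (0 , 0)
  :1 = con (1 , 0)

-- The quotient of a commutative ring by a principal ideal.

module QuotientRing {c ℓ} (R : CommutativeRing c ℓ) (p : CommutativeRing.Carrier R) where
  open CommutativeRing R
  open CommutativeRingSolver R
  open import Algebra.Properties.Semigroup.Divisibility *-semigroup using (_∣_; _,_)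
  open import Relation.Binary.Reasoning.Setoid setoid

  infix 4 _≈ₚ_
  -- A record rather than a synonym, so that unification can read `x` and `y` off the type; from the
  -- bare difference `x - y` they could not be recovered in a concrete ring.
  record _≈ₚ_ (x y : Carrier) : Set (c ⊔ ℓ) where
    constructor congruent
    field divides : p ∣ x - y

  ≈⇒≈ₚ : ∀ {x y} → x ≈ y → x ≈ₚ y
  ≈⇒≈ₚ {x} {y} x≈y = congruent (0# , trans (zeroˡ p) (sym (trans (+-congʳ x≈y) (-‿inverseʳ y))))

  symₚ : ∀ {x y} → x ≈ₚ y → y ≈ₚ x
  symₚ {x} {y} (congruent (k , e)) = congruent (- k , trans (solve 2 (λ k p → :- k :* p := :- (k :* p)) refl k p)
    (trans (-‿cong e) (solve 2 (λ x y → :- (x :- y) := y :- x) refl x y)))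

  transₚ : ∀ {x y z} → x ≈ₚ y → y ≈ₚ z → x ≈ₚ z
  transₚ {x} {y} {z} (congruent (k , e)) (congruent (l , f)) = congruent (k + l , trans (distribʳ p k l)
    (trans (+-cong e f) (solve 3 (λ x y z → (x :- y) :+ (y :- z) := x :- z) refl x y z)))

  +-congₚ : ∀ {x y u v} → x ≈ₚ y → u ≈ₚ v → x + u ≈ₚ y + v
  +-congₚ {x} {y} {u} {v} (congruent (k , e)) (congruent (l , f)) = congruent (k + l , trans (distribʳ p k l)
    (trans (+-cong e f) (solve 4 (λ x y u v → (x :- y) :+ (u :- v) := (x :+ u) :- (y :+ v)) refl x y u v)))

  *-congₚ : ∀ {x y u v} → x ≈ₚ y → u ≈ₚ v → x * u ≈ₚ y * v
  *-congₚ {x} {y} {u} {v} (congruent (k , e)) (congruent (l , f)) = congruent (k * u + y * l ,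
    trans (solve 5 (λ k u y l p → (k :* u :+ y :* l) :* p := (k :* p) :* u :+ y :* (l :* p)) refl k u y l p)
    (trans (+-cong (*-congʳ e) (*-congˡ f))
      (solve 4 (λ x y u v → (x :- y) :* u :+ y :* (u :- v) := x :* u :- y :* v) refl x y u v)))

  -‿congₚ : ∀ {x y} → x ≈ₚ y → - x ≈ₚ - y
  -‿congₚ {x} {y} (congruent (k , e)) = congruent (- k , trans (solve 2 (λ k p → :- k :* p := :- (k :* p)) refl k p)
    (trans (-‿cong e) (solve 2 (λ x y → :- (x :- y) := :- x :- :- y) refl x y)))

  quotientRing : CommutativeRing c (c ⊔ ℓ)
  quotientRing = record
    { Carrier = Carrier
    ; _≈_ = _≈ₚ_
    ; _+_ = _+_
    ; _*_ = _*_
    ; -_ = -_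
    ; 0# = 0#
    ; 1# = 1#
    ; isCommutativeRing = record
      { isRing = record
        { +-isAbelianGroup = record
          { isGroup = record
            { isMonoid = record
              { isSemigroup = record
                { isMagma = record
                  { isEquivalence = record { refl = ≈⇒≈ₚ refl ; sym = symₚ ; trans = transₚ }
                  ; ∙-cong = +-congₚ }
                ; assoc = λ x y z → ≈⇒≈ₚ (+-assoc x y z) }
              ; identity = (λ x → ≈⇒≈ₚ (+-identityˡ x)) , (λ x → ≈⇒≈ₚ (+-identityʳ x)) }
            ; inverse = (λ x → ≈⇒≈ₚ (-‿inverseˡ x)) , (λ x → ≈⇒≈ₚ (-‿inverseʳ x))
            ; ⁻¹-cong = -‿congₚ }
          ; comm = λ x y → ≈⇒≈ₚ (+-comm x y) }
        ; *-cong = *-congₚ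
        ; *-assoc = λ x y z → ≈⇒≈ₚ (*-assoc x y z)
        ; *-identity = (λ x → ≈⇒≈ₚ (*-identityˡ x)) , (λ x → ≈⇒≈ₚ (*-identityʳ x))
        ; distrib = (λ x y z → ≈⇒≈ₚ (distribˡ x y z)) , (λ x y z → ≈⇒≈ₚ (distribʳ x y z))
        }
      ; *-comm = λ x y → ≈⇒≈ₚ (*-comm x y)
      }
    }

  ∣⇒≈0 : ∀ {x} → p ∣ x → x ≈ₚ 0#
  ∣⇒≈0 {x} (k , e) = congruent (k , trans e (solve 1 (λ x → x := x :- :0) refl x))

  ≈0⇒∣ : ∀ {x} → x ≈ₚ 0# → p ∣ x
  ≈0⇒∣ {x} (congruent (k , e)) = k , trans e (solve 1 (λ x → x :- :0 := x) refl x)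

  -- Brings a congruence modulo `p` into the shape of `CongMod`: modulus times cofactor, plus `p`
  -- times an explicit element.
  residue : ∀ {x} u v → x ≈ₚ u * v → ∃ λ r → x ≈ v * u + p * r
  residue {x} u v (congruent (r , e)) = r , (begin
    x                        ≈⟨ solve 3 (λ x u v → x := v :* u :+ (x :- u :* v)) refl x u v ⟩
    v * u + (x - u * v)      ≈⟨ +-congˡ e ⟨
    v * u + r * p            ≈⟨ +-congˡ (*-comm r p) ⟩
    v * u + p * r            ∎)

-- Powers that fix an element, and geometric sums.

module FixedElements {c ℓ} (R : CommutativeRing c ℓ) where
  open CommutativeRing R hiding (zero)
  open CommutativeRingSolver R
  open Exp commutativeSemiring using (_^_; ^-homo-*; ^-assocʳ)
  open import Algebra.Properties.Semiring.Mult semiring using () renaming (_×_ to _·_)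
  open import Relation.Binary.Reasoning.Setoid setoid

  fixed-^ : ∀ {x f} → x * f ≈ f → ∀ n → x ^ n * f ≈ f
  fixed-^ e zero = *-identityˡ _
  fixed-^ {x} {f} e (suc n) = trans (*-assoc x (x ^ n) f) (trans (*-congˡ (fixed-^ e n)) e)

  fixed-multiple : ∀ {t f} m k → t ^ m * f ≈ f → t ^ (k ℕ.* m) * f ≈ f
  fixed-multiple {t} m k e = trans
    (*-congʳ (trans (reflexive (≡.cong (t ^_) (ℕₚ.*-comm k m))) (sym (^-assocʳ t m k)))) (fixed-^ e k)

  fixed-difference : ∀ {t f} a b c → a ℕ.+ b ≡ c → t ^ b * f ≈ f → t ^ c * f ≈ f → t ^ a * f ≈ f
  fixed-difference {t} {f} a b _ ≡.refl e e′ = begin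
    t ^ a * f                 ≈⟨ *-congˡ e ⟨
    t ^ a * (t ^ b * f)       ≈⟨ *-assoc _ _ _ ⟨
    (t ^ a * t ^ b) * f       ≈⟨ *-congʳ (^-homo-* t a b) ⟨
    t ^ (a ℕ.+ b) * f         ≈⟨ e′ ⟩
    f                         ∎

  -- Bézout's identity is taken in the subtraction-free form g + y n = x m, because no inverse of
  -- `t` is at hand: t^g f = t^g t^(yn) f = t^(xm) f = f.
  fixed-gcd : ∀ {t f} m n → t ^ m * f ≈ f → t ^ n * f ≈ f → t ^ gcd m n * f ≈ f
  fixed-gcd m n e e′ with Bézout.identity (gcd-GCD m n)
  ... | Bézout.+- x y eq =
    fixed-difference (gcd m n) (y ℕ.* n) (x ℕ.* m) eq (fixed-multiple n y e′) (fixed-multiple m x e)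
  ... | Bézout.-+ x y eq =
    fixed-difference (gcd m n) (x ℕ.* m) (y ℕ.* n) eq (fixed-multiple m x e) (fixed-multiple n y e′)

  odd-power : ∀ {x} → x ≈ - 1# → ∀ k → k % 2 ≡ 1 → x ^ k ≈ - 1#
  odd-power x≈-1 1 _ = trans (*-identityʳ _) x≈-1
  odd-power {x} x≈-1 (suc (suc k)) odd = begin
    -- `odd` also serves for `k`, since `% 2` computes by removing two successors.
    x * (x * x ^ k)               ≈⟨ *-cong x≈-1 (*-cong x≈-1 (odd-power x≈-1 k odd)) ⟩
    - 1# * (- 1# * - 1#)          ≈⟨ solve 0 (:- :1 :* (:- :1 :* :- :1) := :- :1) refl ⟩
    - 1#                          ∎

  geometric : ℕ → Carrier → Carrier
  geometric zero x = 0#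
  geometric (suc k) x = 1# + x * geometric k x

  geometric-telescope : ∀ k x → (x - 1#) * geometric k x ≈ x ^ k - 1#
  geometric-telescope zero x = solve 1 (λ x → (x :- :1) :* :0 := :1 :- :1) refl x
  geometric-telescope (suc k) x = begin
    (x - 1#) * (1# + x * geometric k x)
      ≈⟨ solve 2 (λ x g → (x :- :1) :* (:1 :+ x :* g) := (x :- :1) :+ x :* ((x :- :1) :* g)) refl x (geometric k x) ⟩
    (x - 1#) + x * ((x - 1#) * geometric k x)
      ≈⟨ +-congˡ (*-congˡ (geometric-telescope k x)) ⟩
    (x - 1#) + x * (x ^ k - 1#)
      ≈⟨ solve 2 (λ x y → (x :- :1) :+ x :* (y :- :1) := x :* y :- :1) refl x (x ^ k) ⟩
    x ^ suc k - 1# ∎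

  -- Each of the `k` powers of `x` in the sum acts on `f` as 1.
  geometric-fixed : ∀ k {x f} → x * f ≈ f → geometric k x * f ≈ k · 1# * f
  geometric-fixed zero e = refl
  geometric-fixed (suc k) {x} {f} e = begin
    (1# + x * geometric k x) * f
      ≈⟨ solve 3 (λ x g f → (:1 :+ x :* g) :* f := f :+ g :* (x :* f)) refl x (geometric k x) f ⟩
    f + geometric k x * (x * f)
      ≈⟨ +-congˡ (trans (*-congˡ e) (geometric-fixed k e)) ⟩
    f + k · 1# * f
      ≈⟨ solve 2 (λ k f → f :+ k :* f := (:1 :+ k) :* f) refl (k · 1#) f ⟩
    (1# + k · 1#) * f ∎

-- The operations of a quotient ring are those of the ring itself, but derived operations mention the
-- equality of the ring they are taken in.
module QuotientOperations {c ℓ} (R : CommutativeRing c ℓ) (p : CommutativeRing.Carrier R) where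
  open CommutativeRing R hiding (zero)
  open QuotientRing R p using (quotientRing)
  open Exp commutativeSemiring using (_^_)
  open import Algebra.Properties.Semiring.Mult semiring using () renaming (_×_ to _·_)
  module Q where
    open Exp (CommutativeRing.commutativeSemiring quotientRing) public using (_^_)
    open import Algebra.Properties.Semiring.Mult (CommutativeRing.semiring quotientRing) public
      using () renaming (_×_ to _·_)
    open FixedElements quotientRing public using (geometric)

  ^-quotient : ∀ x n → x Q.^ n ≡ x ^ n
  ^-quotient x zero = ≡.refl
  ^-quotient x (suc n) = ≡.cong (x *_) (^-quotient x n)

  ·-quotient : ∀ n x → n Q.· x ≡ n · x
  ·-quotient zero x = ≡.refl
  ·-quotient (suc n) x = ≡.cong (λ y → x + y) (·-quotient n x)

  geometric-quotient : ∀ k x → Q.geometric k x ≡ FixedElements.geometric R k x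
  geometric-quotient zero x = ≡.refl
  geometric-quotient (suc k) x = ≡.cong (λ y → 1# + x * y) (geometric-quotient k x)

-- Finite sums.

module FiniteSums {c ℓ} (R : CommutativeRing c ℓ) where
  open CommutativeRing R hiding (zero)
  open import Algebra.Properties.CommutativeSemigroup +-commutativeSemigroup using (interchange)

  Σ< : ℕ → (ℕ → Carrier) → Carrier
  Σ< zero f = 0#
  Σ< (suc n) f = f 0 + Σ< n (f ∘ suc)

  Σ<-cong : ∀ n {f g} → (∀ j → j < n → f j ≈ g j) → Σ< n f ≈ Σ< n g
  Σ<-cong zero f≈g = refl
  Σ<-cong (suc n) f≈g = +-cong (f≈g 0 (s≤s z≤n)) (Σ<-cong n (λ j j<n → f≈g (suc j) (s≤s j<n)))

  Σ<-+ : ∀ n f g → Σ< n (λ j → f j + g j) ≈ Σ< n f + Σ< n g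
  Σ<-+ zero f g = sym (+-identityˡ 0#)
  Σ<-+ (suc n) f g = trans (+-congˡ (Σ<-+ n (f ∘ suc) (g ∘ suc))) (interchange _ _ _ _)

  Σ<-last : ∀ n f → Σ< (suc n) f ≈ Σ< n f + f n
  Σ<-last zero f = +-comm (f 0) 0#
  Σ<-last (suc n) f = trans (+-congˡ (Σ<-last n (f ∘ suc))) (sym (+-assoc _ _ _))

  Σ<-* : ∀ n r f → Σ< n (λ j → r * f j) ≈ r * Σ< n f
  Σ<-* zero r f = sym (zeroʳ r)
  Σ<-* (suc n) r f = trans (+-congˡ (Σ<-* n r (f ∘ suc))) (sym (distribˡ r _ _))

  foldr-applyUpTo : ∀ (f : ℕ → Carrier) (h : ℕ → ℕ) n → foldr _+_ 0# (map f (applyUpTo h n)) ≡ Σ< n (f ∘ h)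
  foldr-applyUpTo f h zero = ≡.refl
  foldr-applyUpTo f h (suc n) = ≡.cong (λ y → f (h 0) + y) (foldr-applyUpTo f (h ∘ suc) n)

-- Gaussian binomials and the q-binomial theorem.

module GaussianBinomials {c ℓ} (R : CommutativeRing c ℓ) (q : CommutativeRing.Carrier R) where
  open CommutativeRing R hiding (zero)
  open CommutativeRingSolver R
  open FiniteSums R
  open Exp commutativeSemiring using (_^_)
  open import Relation.Binary.Reasoning.Setoid setoid

  gauss : ℕ → ℕ → Carrier
  gauss n zero = 1#
  gauss zero (suc m) = 0#
  gauss (suc n) (suc m) = gauss n m + q ^ suc m * gauss n (suc m)

  gauss-> : ∀ {n m} → n < m → gauss n m ≈ 0#
  gauss-> {zero} (s≤s _) = refl
  gauss-> {suc n} (s≤s n<m) =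
    trans (+-cong (gauss-> n<m) (trans (*-congˡ (gauss-> (ℕₚ.m≤n⇒m≤1+n n<m))) (zeroʳ _))) (+-identityˡ 0#)

  gauss-n-n : ∀ n → gauss n n ≈ 1#
  gauss-n-n zero = refl
  gauss-n-n (suc n) =
    trans (+-cong (gauss-n-n n) (trans (*-congˡ (gauss-> (ℕₚ.n<1+n n))) (zeroʳ _))) (+-identityʳ 1#)

  -- One induction proves both this and `gauss-lower`, the division-free form of [n+1, m] / [n, m] =
  -- (q^(n+1) - 1) / (q^(n+1-m) - 1). Absorption at (n+1, m) uses both at (n, m), and `gauss-lower`
  -- at (n, m+1) uses absorption at (n, m).
  gauss-absorption : ∀ n m →
    (q ^ suc m - 1#) * gauss (suc n) (suc m) ≈ (q ^ suc n - 1#) * gauss n m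
  gauss-lower : ∀ n m →
    q ^ m * ((q ^ suc n - 1#) * gauss n m) ≈ (q ^ suc n - q ^ m) * gauss (suc n) m

  gauss-lower n zero = solve 1 (λ a → :1 :* ((a :- :1) :* :1) := (a :- :1) :* :1) refl (q ^ suc n)
  gauss-lower n (suc m) = begin
    b * ((a - 1#) * z)
      ≈⟨ solve 4 (λ a b y z → b :* ((a :- :1) :* z) :=
                              (a :- :1) :* (y :+ b :* z) :- (a :- :1) :* y) refl a b y z ⟩
    (a - 1#) * (y + b * z) - (a - 1#) * y
      ≈⟨ +-congˡ (-‿cong (gauss-absorption n m)) ⟨
    (a - 1#) * (y + b * z) - (b - 1#) * (y + b * z)
      ≈⟨ solve 3 (λ a b x → (a :- :1) :* x :- (b :- :1) :* x := (a :- b) :* x) refl a b (y + b * z) ⟩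
    (a - b) * (y + b * z) ∎
    where
    a = q ^ suc n
    b = q ^ suc m
    y = gauss n m
    z = gauss n (suc m)

  gauss-absorption zero zero =
    solve 1 (λ q → (q :* :1 :- :1) :* (:1 :+ (q :* :1) :* :0) := (q :* :1 :- :1) :* :1) refl q
  gauss-absorption zero (suc m) =
    solve 2 (λ q b → (b :- :1) :* (:0 :+ b :* :0) := (q :- :1) :* :0) refl (q * 1#) (q ^ suc (suc m))
  gauss-absorption (suc n) m = begin
    (q * b - 1#) * (x + (q * b) * w)
      ≈⟨ solve 4 (λ b q x w → (q :* b :- :1) :* (x :+ (q :* b) :* w) :=
            (q :* b :- :1) :* x :+ q :* (b :* ((q :* b :- :1) :* w))) refl b q x w ⟩
    (q * b - 1#) * x + q * (b * ((q * b - 1#) * w))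
      ≈⟨ +-congˡ (*-congˡ (*-congˡ (gauss-absorption n m))) ⟩
    (q * b - 1#) * x + q * (b * ((a - 1#) * gauss n m))
      ≈⟨ +-congˡ (*-congˡ (gauss-lower n m)) ⟩
    (q * b - 1#) * x + q * ((a - b) * x)
      ≈⟨ solve 4 (λ a b q x → (q :* b :- :1) :* x :+ q :* ((a :- b) :* x) := (q :* a :- :1) :* x) refl a b q x ⟩
    (q * a - 1#) * x ∎
    where
    a = q ^ suc n
    b = q ^ m
    x = gauss (suc n) m
    w = gauss (suc n) (suc m)

  -- The expansion of (x + y)^n for y x = q x y, with an arbitrary value `g i j` in place of x^i
  -- y^j. Multiplying x^i y^j by x + y on the right gives x^i y^(j+1) + q^j x^(i+1) y^j, which is
  -- the recursion.
  convolution : ℕ → (ℕ → ℕ → Carrier) → Carrier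
  convolution zero g = g 0 0
  convolution (suc n) g = convolution n (λ i j → g i (suc j) + q ^ j * g (suc i) j)

  convolution-Σ : ∀ n g → convolution n g ≈ Σ< (suc n) (λ j → gauss n j * g (n ∸ j) j)
  convolution-Σ zero g = sym (trans (+-identityʳ _) (*-identityˡ _))
  convolution-Σ (suc n) g = begin
    convolution n (λ i j → g i (suc j) + q ^ j * g (suc i) j)
      ≈⟨ convolution-Σ n _ ⟩
    Σ< (suc n) (λ j → gauss n j * (g (n ∸ j) (suc j) + q ^ j * g (suc (n ∸ j)) j))
      ≈⟨ Σ<-cong (suc n) (λ j _ → distribˡ (gauss n j) (g (n ∸ j) (suc j)) (q ^ j * g (suc (n ∸ j)) j)) ⟩
    Σ< (suc n) (λ j → lower j + upper j)
      ≈⟨ Σ<-+ (suc n) lower upper ⟩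
    Σ< (suc n) lower + Σ< (suc n) upper
      ≈⟨ +-congˡ (Σ<-cong (suc n) (λ { j (s≤s j≤n) → upper≈ j≤n })) ⟩
    Σ< (suc n) lower + Σ< (suc n) upper′
      ≈⟨ +-congˡ (+-identityʳ _) ⟨
    -- This zero is the term of `upper′` at n + 1, where `gauss n (suc n)` vanishes. With it the
    -- second sum can shed its first term instead, and the q-Pascal rule pairs the rest with
    -- `lower`.
    Σ< (suc n) lower + (Σ< (suc n) upper′ + 0#)
      ≈⟨ +-congˡ (+-congˡ (trans (*-congʳ (trans (*-congˡ (gauss-> (ℕₚ.n<1+n n))) (zeroʳ _))) (zeroˡ _))) ⟨
    Σ< (suc n) lower + (Σ< (suc n) upper′ + upper′ (suc n))
      ≈⟨ +-congˡ (Σ<-last (suc n) upper′) ⟨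
    Σ< (suc n) lower + (upper′ 0 + Σ< (suc n) (upper′ ∘ suc))
      ≈⟨ solve 3 (λ x y z → x :+ (y :+ z) := y :+ (x :+ z)) refl _ _ _ ⟩
    upper′ 0 + (Σ< (suc n) lower + Σ< (suc n) (upper′ ∘ suc))
      ≈⟨ +-congˡ (Σ<-+ (suc n) lower (upper′ ∘ suc)) ⟨
    upper′ 0 + Σ< (suc n) (λ j → lower j + upper′ (suc j))
      ≈⟨ +-cong (*-congʳ (*-identityˡ 1#)) (Σ<-cong (suc n) (λ j _ →
           sym (distribʳ (g (n ∸ j) (suc j)) (gauss n j) (q ^ suc j * gauss n (suc j))))) ⟩
    Σ< (suc (suc n)) (λ j → gauss (suc n) j * g (suc n ∸ j) j) ∎
    where
    lower upper upper′ : ℕ → Carrier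
    lower j = gauss n j * g (n ∸ j) (suc j)
    upper j = gauss n j * (q ^ j * g (suc (n ∸ j)) j)
    upper′ j = (q ^ j * gauss n j) * g (suc n ∸ j) j
    upper≈ : ∀ {j} → j ≤ n → upper j ≈ upper′ j
    upper≈ {j} j≤n = begin
      gauss n j * (q ^ j * g (suc (n ∸ j)) j)
        ≈⟨ *-congˡ (*-congˡ (reflexive (≡.cong (λ i → g i j) (≡.sym (ℕₚ.+-∸-assoc 1 j≤n))))) ⟩
      gauss n j * (q ^ j * g (suc n ∸ j) j)
        ≈⟨ solve 3 (λ x y z → x :* (y :* z) := (y :* x) :* z) refl _ _ _ ⟩
      (q ^ j * gauss n j) * g (suc n ∸ j) j ∎

-- Divisibility of iterates by powers of φ, in an abstract ring.

record CyclotomicSetting {c ℓ} (R : CommutativeRing c ℓ) : Set (c ⊔ ℓ) where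
  open CommutativeRing R
  open Exp commutativeSemiring using (_^_)
  open SemigroupDivisibility *-semigroup using (_∣_)
  field
    q ω φ γ : Carrier
    -- With the predecessor stored, `N` is visibly a successor, and the expansion of N steps splits
    -- into a first term, `N-1` middle terms and a last term.
    N-1 : ℕ
    qᴺ : φ * γ ≈ q ^ suc N-1 - 1#
    ωᴺ : ω ^ suc N-1 ≈ - 1#
    φ∣gauss : ∀ {j} → j < N-1 → φ ∣ GaussianBinomials.gauss R q (suc N-1) (suc j)

  N : ℕ
  N = suc N-1

module Vanishing {c ℓ} (R : CommutativeRing c ℓ) (S : CyclotomicSetting R) where
  open CommutativeRing R hiding (zero)
  open CommutativeRingSolver R
  open FiniteSums R
  open CyclotomicSetting S
  open GaussianBinomials R q
  open Exp commutativeSemiring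
    using (_^_; ^-homo-*; ^-congʳ; ^-congˡ; ^-distrib-*; ^-assocʳ)
  open import Algebra.Properties.Semiring.Mult semiring using (×-homo-+) renaming (_×_ to _·_)
  open SemigroupDivisibility *-semigroup
    using (_∣_; _∣ʳ_; _,_; ∣ʳ-respʳ-≈)
  open import Algebra.Properties.CommutativeSemigroup.Divisibility *-commutativeSemigroup
    using (x∣y⇒zx∣zy)
  open import Relation.Binary.Reasoning.Setoid setoid

  Seq : Set c
  Seq = ℕ → Carrier

  infix 4 _≗_
  _≗_ : Seq → Seq → Set ℓ
  f ≗ g = ∀ m → f m ≈ g m

  step : Seq → Seq
  step f m = ω * f (suc m) + q ^ m * f m

  steps : ℕ → Seq → Seq
  steps zero f = f
  steps (suc n) f = steps n (step f)

  steps-cong : ∀ n {f g} → f ≗ g → steps n f ≗ steps n g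
  steps-cong zero f≗g = f≗g
  steps-cong (suc n) f≗g =
    steps-cong n (λ m → +-cong (*-congˡ (f≗g (suc m))) (*-congˡ (f≗g m)))

  steps-+ : ∀ n f g → steps n (λ m → f m + g m) ≗ λ m → steps n f m + steps n g m
  steps-+ zero f g m = refl
  steps-+ (suc n) f g m = trans
    (steps-cong n (λ m → solve 6 (λ z x y Q u v → z :* (x :+ y) :+ Q :* (u :+ v) :=
      (z :* x :+ Q :* u) :+ (z :* y :+ Q :* v)) refl ω (f (suc m)) (g (suc m)) (q ^ m) (f m) (g m)) m)
    (steps-+ n (step f) (step g) m)

  steps-* : ∀ n r f → steps n (λ m → r * f m) ≗ λ m → r * steps n f m
  steps-* zero r f m = refl
  steps-* (suc n) r f m = trans
    (steps-cong n (λ m → solve 5 (λ z r x Q u → z :* (r :* x) :+ Q :* (r :* u) :=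
      r :* (z :* x :+ Q :* u)) refl ω r (f (suc m)) (q ^ m) (f m)) m)
    (steps-* n r (step f) m)

  steps-∘ : ∀ n k f → steps (n ℕ.+ k) f ≡ steps k (steps n f)
  steps-∘ zero k f = ≡.refl
  steps-∘ (suc n) k f = steps-∘ n k (step f)

  -- The value at `m` of x^i y^j f, where x multiplies a sequence by q^m and y is ω times the shift.
  -- These operators satisfy y x = q x y, and `step` is x + y.
  monomial : Seq → ℕ → ℕ → ℕ → Carrier
  monomial f m i j = (q ^ m) ^ i * (ω ^ j * f (m ℕ.+ j))

  convolution-cong : ∀ n {g h} → (∀ i j → g i j ≈ h i j) → convolution n g ≈ convolution n h
  convolution-cong zero g≈h = g≈h 0 0
  convolution-cong (suc n) g≈h = convolution-cong n (λ i j → +-cong (g≈h i (suc j)) (*-congˡ (g≈h (suc i) j)))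

  -- Both recursions spend a factor x + y on the same side: `steps` applies it to `f` first, and
  -- `convolution` multiplies by it on the right.
  steps-convolution : ∀ n f m → steps n f m ≈ convolution n (monomial f m)
  steps-convolution zero f m =
    sym (trans (*-identityˡ _) (trans (*-identityˡ _) (reflexive (≡.cong f (ℕₚ.+-identityʳ m)))))
  steps-convolution (suc n) f m = trans (steps-convolution n (step f) m) (convolution-cong n expand)
    where
    expand : ∀ i j → monomial (step f) m i j ≈ monomial f m i (suc j) + q ^ j * monomial f m (suc i) j
    expand i j = begin
      (q ^ m) ^ i * (ω ^ j * (ω * f (suc (m ℕ.+ j)) + q ^ (m ℕ.+ j) * f (m ℕ.+ j)))
        ≈⟨ *-congˡ (*-congˡ (+-cong (*-congˡ (reflexive (≡.cong f (≡.sym (ℕₚ.+-suc m j)))))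
             (*-congʳ (^-homo-* q m j)))) ⟩
      (q ^ m) ^ i * (ω ^ j * (ω * f (m ℕ.+ suc j) + (q ^ m * q ^ j) * f (m ℕ.+ j)))
        ≈⟨ solve 7 (λ I J z x Q P y → I :* (J :* (z :* x :+ (Q :* P) :* y)) :=
             I :* ((z :* J) :* x) :+ P :* ((Q :* I) :* (J :* y))) refl
             ((q ^ m) ^ i) (ω ^ j) ω (f (m ℕ.+ suc j)) (q ^ m) (q ^ j) (f (m ℕ.+ j)) ⟩
      (q ^ m) ^ i * ((ω * ω ^ j) * f (m ℕ.+ suc j)) + q ^ j * ((q ^ m * (q ^ m) ^ i) * (ω ^ j * f (m ℕ.+ j))) ∎

  steps-Σ : ∀ n f m → steps n f m ≈ Σ< (suc n) (λ j → gauss n j * monomial f m (n ∸ j) j)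
  steps-Σ n f m = trans (steps-convolution n f m) (convolution-Σ n (monomial f m))

  -- At 0 the factor (q^m)^i of every monomial is 1, so the q-binomial expansion becomes the sum of
  -- the theorem.
  steps-weighted : ∀ n z (h : Seq) → steps n (λ m → (q ^ m) ^ z * h m) 0 ≈
    Σ< (suc n) (λ j → (ω ^ j * h j) * (q ^ (z ℕ.* j) * gauss n j))
  steps-weighted n z h = trans (steps-Σ n (λ m → (q ^ m) ^ z * h m) 0) (Σ<-cong (suc n) λ j _ → begin
    gauss n j * (1# ^ (n ∸ j) * (ω ^ j * ((q ^ j) ^ z * h j)))
      ≈⟨ *-congˡ (*-cong (1^ (n ∸ j)) (*-congˡ (*-congʳ (trans (^-assocʳ q j z) (^-congʳ q (ℕₚ.*-comm j z)))))) ⟩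
    gauss n j * (1# * (ω ^ j * (q ^ (z ℕ.* j) * h j)))
      ≈⟨ solve 4 (λ g x y e → g :* (:1 :* (x :* (y :* e))) := (x :* e) :* (y :* g)) refl
           (gauss n j) (ω ^ j) (q ^ (z ℕ.* j)) (h j) ⟩
    (ω ^ j * h j) * (q ^ (z ℕ.* j) * gauss n j) ∎)
    where
    1^ : ∀ i → 1# ^ i ≈ 1#
    1^ zero = refl
    1^ (suc i) = trans (*-identityˡ (1# ^ i)) (1^ i)

  -- The quotient of `gauss N (suc j)` by φ. The value 0 outside the range makes it total, because
  -- `Σ<-deg` asks for a degree bound at every index.
  β : ℕ → Carrier
  β j with j ℕₚ.<? N-1
  ... | yes j<N-1 = _∣ʳ_.quotient (φ∣gauss j<N-1)
  ... | no _ = 0#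

  gauss-N : ∀ j → j < N-1 → gauss N (suc j) ≈ φ * β j
  gauss-N j j<N-1 with j ℕₚ.<? N-1
  ... | yes j<N-1 = trans (sym (_∣ʳ_.equality (φ∣gauss j<N-1))) (*-comm _ φ)
  ... | no j≮N-1 = contradiction j<N-1 j≮N-1

  remainder : Seq → Seq
  remainder f m = Σ< N-1 (λ j → β j * monomial f m (N-1 ∸ j) (suc j))

  steps-N : ∀ f m → steps N f m ≈ ((q ^ m) ^ N * f m - f (m ℕ.+ N)) + φ * remainder f m
  steps-N f m = begin
    steps N f m
      ≈⟨ steps-Σ N f m ⟩
    t 0 + Σ< N (t ∘ suc)
      ≈⟨ +-cong first (Σ<-last N-1 (t ∘ suc)) ⟩
    (q ^ m) ^ N * f m + (Σ< N-1 (t ∘ suc) + t N)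
      ≈⟨ +-congˡ (+-cong (Σ<-cong N-1 middle) last) ⟩
    (q ^ m) ^ N * f m + (Σ< N-1 (λ j → φ * (β j * monomial f m (N-1 ∸ j) (suc j))) + - f (m ℕ.+ N))
      ≈⟨ +-congˡ (+-congʳ (Σ<-* N-1 φ _)) ⟩
    (q ^ m) ^ N * f m + (φ * remainder f m + - f (m ℕ.+ N))
      ≈⟨ solve 3 (λ x y z → x :+ (y :+ z) := (x :+ z) :+ y) refl _ _ _ ⟩
    ((q ^ m) ^ N * f m - f (m ℕ.+ N)) + φ * remainder f m ∎
    where
    t : ℕ → Carrier
    t j = gauss N j * monomial f m (N ∸ j) j
    first : t 0 ≈ (q ^ m) ^ N * f m
    first = trans (*-identityˡ _) (*-congˡ (trans (*-identityˡ _) (reflexive (≡.cong f (ℕₚ.+-identityʳ m)))))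
    middle : ∀ j → j < N-1 → t (suc j) ≈ φ * (β j * monomial f m (N-1 ∸ j) (suc j))
    middle j j< = trans (*-congʳ (gauss-N j j<)) (*-assoc _ _ _)
    last : t N ≈ - f (m ℕ.+ N)
    last = begin
      gauss N N * ((q ^ m) ^ (N ∸ N) * (ω ^ N * f (m ℕ.+ N)))
        ≈⟨ *-cong (gauss-n-n N) (*-cong (^-congʳ (q ^ m) (ℕₚ.n∸n≡0 N)) (*-congʳ ωᴺ)) ⟩
      1# * (1# * (- 1# * f (m ℕ.+ N)))
        ≈⟨ solve 1 (λ x → :1 :* (:1 :* (:- :1 :* x)) := :- x) refl (f (m ℕ.+ N)) ⟩
      - f (m ℕ.+ N) ∎

  -- G m = (q^(mN) - 1) / φ, see φ*G.
  G : Seq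
  G zero = 0#
  G (suc m) = G m + (q ^ m) ^ N * γ

  ^-swap : ∀ x m n → (x ^ m) ^ n ≈ (x ^ n) ^ m
  ^-swap x m n = trans (^-assocʳ x m n) (trans (^-congʳ x (ℕₚ.*-comm m n)) (sym (^-assocʳ x n m)))

  φ*G : ∀ m → φ * G m ≈ (q ^ m) ^ N - 1#
  φ*G zero = trans (zeroʳ φ) (sym (trans (+-congʳ (^-swap q 0 N)) (-‿inverseʳ 1#)))
  φ*G (suc m) = begin
    φ * (G m + (q ^ m) ^ N * γ)
      ≈⟨ solve 4 (λ p g Q c → p :* (g :+ Q :* c) := p :* g :+ Q :* (p :* c)) refl φ (G m) _ γ ⟩
    φ * G m + (q ^ m) ^ N * (φ * γ)
      ≈⟨ +-cong (φ*G m) (*-congˡ qᴺ) ⟩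
    ((q ^ m) ^ N - 1#) + (q ^ m) ^ N * (q ^ N - 1#)
      ≈⟨ solve 2 (λ x y → (x :- :1) :+ x :* (y :- :1) := y :* x :- :1) refl _ (q ^ N) ⟩
    q ^ N * (q ^ m) ^ N - 1#
      ≈⟨ +-congʳ (^-distrib-* q (q ^ m) N) ⟨
    (q ^ suc m) ^ N - 1# ∎

  -- This is q^((m+k)N) - 1 = (q^(mN) - 1) + q^(mN) (q^(kN) - 1) divided by φ. Since φ cannot be
  -- cancelled here, it is proved from the recursion of `G`.
  G-+ : ∀ m k → G (m ℕ.+ k) ≈ G m + (q ^ m) ^ N * G k
  G-+ m zero = trans (reflexive (≡.cong G (ℕₚ.+-identityʳ m))) (sym (trans (+-congˡ (zeroʳ _)) (+-identityʳ _)))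
  G-+ m (suc k) = begin
    G (m ℕ.+ suc k)
      ≈⟨ reflexive (≡.cong G (ℕₚ.+-suc m k)) ⟩
    G (m ℕ.+ k) + (q ^ (m ℕ.+ k)) ^ N * γ
      ≈⟨ +-cong (G-+ m k) (*-congʳ (trans (^-congˡ N (^-homo-* q m k)) (^-distrib-* (q ^ m) (q ^ k) N))) ⟩
    (G m + (q ^ m) ^ N * G k) + ((q ^ m) ^ N * (q ^ k) ^ N) * γ
      ≈⟨ solve 5 (λ g Q h P c → (g :+ Q :* h) :+ (Q :* P) :* c := g :+ Q :* (h :+ P :* c)) refl (G m) _ (G k) _ γ ⟩
    G m + (q ^ m) ^ N * (G k + (q ^ k) ^ N * γ) ∎

  -- Sequences of degree at most a, where both m and G m have degree 1 and the exponentials q^m have degree 0.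
  data Deg : ℕ → Seq → Set (c ⊔ ℓ) where
    resp : ∀ {a f g} → f ≗ g → Deg a f → Deg a g
    raise : ∀ {a f} → Deg a f → Deg (suc a) f
    constant : ∀ r → Deg 0 (λ _ → r)
    add : ∀ {a f g} → Deg a f → Deg a g → Deg a (λ m → f m + g m)
    scale : ∀ {a f} r → Deg a f → Deg a (λ m → r * f m)
    expo : ∀ {a f} → Deg a f → Deg a (λ m → q ^ m * f m)
    shift : ∀ {a f} j → Deg a f → Deg a (λ m → f (m ℕ.+ j))
    mulVar : ∀ {a f} → Deg a f → Deg (suc a) (λ m → m · 1# * f m)
    mulG : ∀ {a f} → Deg a f → Deg (suc a) (λ m → G m * f m)

  constant-deg : ∀ a r → Deg a (λ _ → r)
  constant-deg zero r = constant r
  constant-deg (suc a) r = raise (constant-deg a r)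

  expo^ : ∀ {a f} n → Deg a f → Deg a (λ m → (q ^ m) ^ n * f m)
  expo^ zero d = resp (λ m → sym (*-identityˡ _)) d
  expo^ (suc n) d = resp (λ m → sym (*-assoc _ _ _)) (expo (expo^ n d))

  Σ<-deg : ∀ {a} n {F : ℕ → Seq} → (∀ j → Deg a (F j)) → Deg a (λ m → Σ< n (λ j → F j m))
  Σ<-deg {a} zero d = constant-deg a 0#
  Σ<-deg (suc n) d = add (d 0) (Σ<-deg n (d ∘ suc))

  remainder-deg : ∀ {a f} → Deg a f → Deg a (remainder f)
  remainder-deg d = Σ<-deg N-1 (λ j → scale (β j) (expo^ (N-1 ∸ j) (scale (ω ^ suc j) (shift (suc j) d))))

  -- Degree at most a - 1, with the zero sequence standing for degree -1; thus differences of
  -- constants fit as well.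
  data Below : ℕ → Seq → Set (c ⊔ ℓ) where
    vanishes : ∀ {f} → f ≗ (λ _ → 0#) → Below 0 f
    deg : ∀ {a f} → Deg a f → Below (suc a) f

  below-raise : ∀ {a f} → Below a f → Below (suc a) f
  below-raise (vanishes e) = deg (resp (λ m → sym (e m)) (constant 0#))
  below-raise (deg d) = deg (raise d)

  below-add : ∀ {a f g} → Below a f → Below a g → Below a (λ m → f m + g m)
  below-add (vanishes e) (vanishes e′) = vanishes (λ m → trans (+-cong (e m) (e′ m)) (+-identityˡ 0#))
  below-add (deg d) (deg d′) = deg (add d d′)

  below-scale : ∀ {a f} r → Below a f → Below a (λ m → r * f m)
  below-scale r (vanishes e) = vanishes (λ m → trans (*-congˡ (e m)) (zeroʳ r))
  below-scale r (deg d) = deg (scale r d)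

  below-expo : ∀ {a f} → Below a f → Below a (λ m → q ^ m * f m)
  below-expo (vanishes e) = vanishes (λ m → trans (*-congˡ (e m)) (zeroʳ _))
  below-expo (deg d) = deg (expo d)

  below-shift : ∀ {a f} j → Below a f → Below a (λ m → f (m ℕ.+ j))
  below-shift j (vanishes e) = vanishes (λ m → e (m ℕ.+ j))
  below-shift j (deg d) = deg (shift j d)

  below-mulVar : ∀ {a f} → Below a f → Deg a (λ m → m · 1# * f m)
  below-mulVar (vanishes e) = resp (λ m → sym (trans (*-congˡ (e m)) (zeroʳ _))) (constant 0#)
  below-mulVar (deg d) = mulVar d

  below-mulG : ∀ {a f} → Below a f → Deg a (λ m → G m * f m)
  below-mulG (vanishes e) = resp (λ m → sym (trans (*-congˡ (e m)) (zeroʳ _))) (constant 0#)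
  below-mulG (deg d) = mulG d

  record Difference (a : ℕ) (f : Seq) : Set (c ⊔ ℓ) where
    constructor difference
    field
      {u v} : Seq
      u-below : Below a u
      v-deg : Deg a v
      split : ∀ m → f (m ℕ.+ N) - f m ≈ u m + φ * v m

  -- Recursion on the derivation of the degree. Fresh contributions to `v` come from `expo` alone:
  -- q^(m+N) - q^m = φ γ q^m keeps its degree but carries φ. For `mulVar` and `mulG` the increments
  -- N and q^(mN) `G N` have degree 0, so they go into `u`, one degree lower.
  Δ : ∀ {a f} → Deg a f → Difference a f
  Δ (resp f≗g d) with difference U V e ← Δ d =
    difference U V (λ m → trans (+-cong (sym (f≗g (m ℕ.+ N))) (-‿cong (sym (f≗g m)))) (e m))
  Δ (raise d) with difference U V e ← Δ d = difference (below-raise U) (raise V) e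
  Δ (constant r) = difference {u = λ _ → 0#} (vanishes (λ m → refl)) (constant 0#)
    (λ m → solve 2 (λ r p → r :- r := :0 :+ p :* :0) refl r φ)
  Δ (add {f = f} {g} d d′) with difference {u} {v} U V e ← Δ d | difference {u′} {v′} U′ V′ e′ ← Δ d′ =
    difference (below-add U U′) (add V V′) (λ m → begin
      (f (m ℕ.+ N) + g (m ℕ.+ N)) - (f m + g m)
        ≈⟨ solve 4 (λ x y z w → (x :+ y) :- (z :+ w) := (x :- z) :+ (y :- w)) refl _ _ _ _ ⟩
      (f (m ℕ.+ N) - f m) + (g (m ℕ.+ N) - g m)
        ≈⟨ +-cong (e m) (e′ m) ⟩
      (u m + φ * v m) + (u′ m + φ * v′ m)
        ≈⟨ solve 5 (λ p x y z w → (x :+ p :* y) :+ (z :+ p :* w) := (x :+ z) :+ p :* (y :+ w)) refl φ _ _ _ _ ⟩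
      (u m + u′ m) + φ * (v m + v′ m) ∎)
  Δ (scale {f = f} r d) with difference {u} {v} U V e ← Δ d =
    difference (below-scale r U) (scale r V) (λ m → begin
      r * f (m ℕ.+ N) - r * f m
        ≈⟨ solve 3 (λ r x y → r :* x :- r :* y := r :* (x :- y)) refl r _ _ ⟩
      r * (f (m ℕ.+ N) - f m)
        ≈⟨ *-congˡ (e m) ⟩
      r * (u m + φ * v m)
        ≈⟨ solve 4 (λ r p x y → r :* (x :+ p :* y) := r :* x :+ p :* (r :* y)) refl r φ _ _ ⟩
      r * u m + φ * (r * v m) ∎)
  Δ (expo {f = f} d) with difference {u} {v} U V e ← Δ d =
    difference (below-expo U) (expo (add (scale γ (shift N d)) V)) (λ m → begin
      q ^ (m ℕ.+ N) * f (m ℕ.+ N) - q ^ m * f m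
        ≈⟨ +-congʳ (*-congʳ (^-homo-* q m N)) ⟩
      (q ^ m * q ^ N) * f (m ℕ.+ N) - q ^ m * f m
        ≈⟨ solve 4 (λ Q P x y → (Q :* P) :* x :- Q :* y := Q :* ((P :- :1) :* x :+ (x :- y))) refl _ _ _ _ ⟩
      q ^ m * ((q ^ N - 1#) * f (m ℕ.+ N) + (f (m ℕ.+ N) - f m))
        ≈⟨ *-congˡ (+-cong (*-congʳ (sym qᴺ)) (e m)) ⟩
      q ^ m * ((φ * γ) * f (m ℕ.+ N) + (u m + φ * v m))
        ≈⟨ solve 6 (λ Q p c x y z → Q :* ((p :* c) :* x :+ (y :+ p :* z)) :=
              Q :* y :+ p :* (Q :* (c :* x :+ z))) refl _ φ γ _ _ _ ⟩
      q ^ m * u m + φ * (q ^ m * (γ * f (m ℕ.+ N) + v m)) ∎)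
  Δ (shift {f = f} j d) with difference {u} {v} U V e ← Δ d =
    difference (below-shift j U) (shift j V) (λ m → trans
      (+-congʳ (reflexive (≡.cong f (swap m)))) (e (m ℕ.+ j)))
    where
    swap : ∀ m → m ℕ.+ N ℕ.+ j ≡ m ℕ.+ j ℕ.+ N
    swap m = ≡.trans (ℕₚ.+-assoc m N j) (≡.trans (≡.cong (m ℕ.+_) (ℕₚ.+-comm N j)) (≡.sym (ℕₚ.+-assoc m j N)))
  Δ (mulVar {f = f} d) with difference {u} {v} U V e ← Δ d =
    difference (deg (add (below-mulVar U) (scale (N · 1#) (shift N d)))) (mulVar V) (λ m → begin
      (m ℕ.+ N) · 1# * f (m ℕ.+ N) - m · 1# * f m
        ≈⟨ +-congʳ (*-congʳ (×-homo-+ 1# m N)) ⟩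
      (m · 1# + N · 1#) * f (m ℕ.+ N) - m · 1# * f m
        ≈⟨ solve 4 (λ M N x y → (M :+ N) :* x :- M :* y := M :* (x :- y) :+ N :* x) refl _ _ _ _ ⟩
      m · 1# * (f (m ℕ.+ N) - f m) + N · 1# * f (m ℕ.+ N)
        ≈⟨ +-congʳ (*-congˡ (e m)) ⟩
      m · 1# * (u m + φ * v m) + N · 1# * f (m ℕ.+ N)
        ≈⟨ solve 5 (λ M x p y z → M :* (x :+ p :* y) :+ z := (M :* x :+ z) :+ p :* (M :* y)) refl _ _ φ _ _ ⟩
      (m · 1# * u m + N · 1# * f (m ℕ.+ N)) + φ * (m · 1# * v m) ∎)
  Δ (mulG {f = f} d) with difference {u} {v} U V e ← Δ d =
    difference (deg (add (below-mulG U) (expo^ N (scale (G N) (shift N d))))) (mulG V) (λ m → begin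
      G (m ℕ.+ N) * f (m ℕ.+ N) - G m * f m
        ≈⟨ +-congʳ (*-congʳ (G-+ m N)) ⟩
      (G m + (q ^ m) ^ N * G N) * f (m ℕ.+ N) - G m * f m
        ≈⟨ solve 5 (λ M Q g x y → (M :+ Q :* g) :* x :- M :* y := M :* (x :- y) :+ Q :* (g :* x)) refl _ _ _ _ _ ⟩
      G m * (f (m ℕ.+ N) - f m) + (q ^ m) ^ N * (G N * f (m ℕ.+ N))
        ≈⟨ +-congʳ (*-congˡ (e m)) ⟩
      G m * (u m + φ * v m) + (q ^ m) ^ N * (G N * f (m ℕ.+ N))
        ≈⟨ solve 5 (λ M x p y z → M :* (x :+ p :* y) :+ z := (M :* x :+ z) :+ p :* (M :* y)) refl _ _ φ _ _ ⟩
      (G m * u m + (q ^ m) ^ N * (G N * f (m ℕ.+ N))) + φ * (G m * v m) ∎)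

  -- Subtracting and adding f(m) in `steps-N` isolates (q^(mN) - 1) f(m), which `φ*G` rewrites as φ
  -- G(m) f(m): the degree rises, but behind a factor φ. The rest is the difference handled by `Δ`
  -- and the remainder, which keeps the degree.
  steps-N-deg : ∀ {a f} → Deg a f →
    ∃₂ λ u v → Below a u × Deg (suc a) v × steps N f ≗ λ m → u m + φ * v m
  steps-N-deg {f = f} d with difference {u} {v} U V e ← Δ d =
    (λ m → - 1# * u m) , (λ m → G m * f m + (- 1# * v m + remainder f m)) ,
    below-scale (- 1#) U , add (mulG d) (raise (add (scale (- 1#) V) (remainder-deg d))) , λ m → begin
      steps N f m
        ≈⟨ steps-N f m ⟩
      ((q ^ m) ^ N * f m - f (m ℕ.+ N)) + φ * remainder f m
        ≈⟨ solve 4 (λ Q x y z → (Q :* x :- y) :+ z := ((Q :- :1) :* x :- (y :- x)) :+ z) refl _ _ _ _ ⟩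
      (((q ^ m) ^ N - 1#) * f m - (f (m ℕ.+ N) - f m)) + φ * remainder f m
        ≈⟨ +-congʳ (+-cong (*-congʳ (sym (φ*G m))) (-‿cong (e m))) ⟩
      ((φ * G m) * f m - (u m + φ * v m)) + φ * remainder f m
        ≈⟨ solve 6 (λ p g x u v r → ((p :* g) :* x :- (u :+ p :* v)) :+ p :* r :=
              :- :1 :* u :+ p :* (g :* x :+ (:- :1 :* v :+ r))) refl φ _ _ _ _ _ ⟩
      - 1# * u m + φ * (G m * f m + (- 1# * v m + remainder f m)) ∎

  ∣-+ : ∀ {p x y} → p ∣ x → p ∣ y → p ∣ x + y
  ∣-+ {p} (k , e) (l , e′) = k + l , trans (distribʳ p k l) (+-cong e e′)

  steps-zero : ∀ n {f} → f ≗ (λ _ → 0#) → ∀ m → steps n f m ≈ 0#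
  steps-zero n f≗0 m = trans (steps-cong n (λ m → trans (f≗0 m) (sym (zeroˡ 0#))) m)
    (trans (steps-* n 0# (λ _ → 0#) m) (zeroˡ _))

  steps-N+ : ∀ n {f u v} → steps N f ≗ (λ m → u m + φ * v m) →
    ∀ m → steps (N ℕ.+ n) f m ≈ steps n u m + φ * steps n v m
  steps-N+ n {f} {u} {v} eq m = begin
    steps (N ℕ.+ n) f m                     ≡⟨ ≡.cong (λ g → g m) (steps-∘ N n f) ⟩
    steps n (steps N f) m                   ≈⟨ steps-cong n eq m ⟩
    steps n (λ m → u m + φ * v m) m         ≈⟨ steps-+ n u (λ m → φ * v m) m ⟩
    steps n u m + steps n (λ m → φ * v m) m ≈⟨ +-congˡ (steps-* n φ v m) ⟩
    steps n u m + φ * steps n v m           ∎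

  -- The condition is a + 2 e - 1 ≤ M.
  φ^∣steps : ∀ M {a e n f} → a ℕ.+ (e ℕ.+ e) ≤ suc M → M ℕ.* N ≤ n → Deg a f → ∀ m → φ ^ e ∣ steps n f m
  φ^∣steps-N+ : ∀ M {a e n f} → a ℕ.+ (suc e ℕ.+ suc e) ≤ suc (suc M) → M ℕ.* N ≤ n → Deg a f →
    ∀ m → φ ^ suc e ∣ steps (N ℕ.+ n) f m

  φ^∣steps M {e = zero} {n} {f} _ _ _ m = steps n f m , *-identityʳ _
  -- With M = 0 the bound reads a + 2 (e + 1) ≤ 1, which is impossible.
  φ^∣steps zero {a} {suc e} a+2e≤1 _ _ _ = contradiction
    (ℕₚ.≤-trans (ℕₚ.m≤n+m (suc e ℕ.+ suc e) a) a+2e≤1) (ℕₚ.<⇒≱ (s≤s (ℕₚ.≤-trans (s≤s z≤n) (ℕₚ.m≤n+m (suc e) e))))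
  φ^∣steps (suc M) {a} {suc e} {n} {f} bound MN≤n d m =
    ≡.subst (λ n → φ ^ suc e ∣ steps n f m) (ℕₚ.m+[n∸m]≡n N≤n)
      (φ^∣steps-N+ M bound (ℕₚ.m+n≤o⇒m≤o∸n (M ℕ.* N) (≡.subst (_≤ n) (ℕₚ.+-comm N (M ℕ.* N)) MN≤n)) d m)
    where
    N≤n : N ≤ n
    N≤n = ℕₚ.≤-trans (ℕₚ.m≤m+n N (M ℕ.* N)) MN≤n

  -- Both parts of T^N f lower the quantity in the bound by one: `u` keeps the exponent e + 1 and
  -- loses a degree, while `φ * v` gains a degree but asks for only e further powers of φ, worth two
  -- degrees each.
  φ^∣steps-N+ M {a} {e} {n} {f} bound MN≤n d m = combine (steps-N-deg d)
    where
    shuffle : a ℕ.+ (suc e ℕ.+ suc e) ≡ suc (suc a ℕ.+ (e ℕ.+ e))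
    shuffle = ≡.trans (ℕₚ.+-suc a (e ℕ.+ suc e))
      (≡.cong suc (≡.trans (≡.cong (a ℕ.+_) (ℕₚ.+-suc e e)) (ℕₚ.+-suc a (e ℕ.+ e))))
    below-case : ∀ {b u} → b ℕ.+ (suc e ℕ.+ suc e) ≤ suc (suc M) → Below b u → φ ^ suc e ∣ steps n u m
    below-case _ (vanishes u≗0) = 0# , trans (zeroˡ _) (sym (steps-zero n u≗0 m))
    below-case b (deg d′) = φ^∣steps M {e = suc e} (ℕₚ.≤-pred b) MN≤n d′ m
    combine : (∃₂ λ u v → Below a u × Deg (suc a) v × steps N f ≗ λ m → u m + φ * v m) →
      φ ^ suc e ∣ steps (N ℕ.+ n) f m
    combine (u , v , U , V , eq) = ∣ʳ-respʳ-≈ (sym (steps-N+ n eq m))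
      (∣-+ (below-case bound U)
        (x∣y⇒zx∣zy φ (φ^∣steps M {e = e} (ℕₚ.≤-pred (≡.subst (_≤ suc (suc M)) shuffle bound)) MN≤n V m)))

-- Transport of powers, divisibility and Gaussian binomials along ring homomorphisms.

module Homomorphism {a ℓ₁ b ℓ₂} (A : CommutativeRing a ℓ₁) (R : CommutativeRing b ℓ₂)
  (⟦_⟧ : CommutativeRing.Carrier A → CommutativeRing.Carrier R)
  (isHom : IsRingHomomorphism (CommutativeRing.rawRing A) (CommutativeRing.rawRing R) ⟦_⟧) where
  private
    module A where
      open CommutativeRing A public
      open Exp commutativeSemiring public using (_^_)
      open import Algebra.Properties.Semiring.Mult semiring public using () renaming (_×_ to _·_)
      open SemigroupDivisibility *-semigroup public using (_∣_; _,_)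
      open GaussianBinomials A public using (gauss)
  open CommutativeRing R hiding (zero)
  open Exp commutativeSemiring using (_^_)
  open import Algebra.Properties.Semiring.Mult semiring using () renaming (_×_ to _·_)
  open SemigroupDivisibility *-semigroup using (_∣_; _,_)
  open GaussianBinomials R using (gauss)
  open IsRingHomomorphism isHom public

  ^-homo : ∀ x n → ⟦ x A.^ n ⟧ ≈ ⟦ x ⟧ ^ n
  ^-homo x zero = 1#-homo
  ^-homo x (suc n) = trans (*-homo x (x A.^ n)) (*-congˡ (^-homo x n))

  ·1-homo : ∀ n → ⟦ n A.· A.1# ⟧ ≈ n · 1#
  ·1-homo zero = 0#-homo
  ·1-homo (suc n) = trans (+-homo A.1# (n A.· A.1#)) (+-cong 1#-homo (·1-homo n))

  ∣-homo : ∀ {x y} → x A.∣ y → ⟦ x ⟧ ∣ ⟦ y ⟧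
  ∣-homo {x} (w , e) = ⟦ w ⟧ , trans (sym (*-homo w x)) (⟦⟧-cong e)

  kernel-∣ : ∀ {x y} → x A.∣ y → ⟦ x ⟧ ≈ 0# → ⟦ y ⟧ ≈ 0#
  kernel-∣ {x} (w , e) x≈0 = trans (⟦⟧-cong (A.sym e)) (trans (*-homo w x) (trans (*-congˡ x≈0) (zeroʳ _)))

  gauss-homo : ∀ q n m → ⟦ A.gauss q n m ⟧ ≈ gauss ⟦ q ⟧ n m
  gauss-homo q n zero = 1#-homo
  gauss-homo q zero (suc m) = 0#-homo
  gauss-homo q (suc n) (suc m) = trans (+-homo _ _) (+-cong (gauss-homo q n m)
    (trans (*-homo _ _) (*-cong (^-homo q (suc m)) (gauss-homo q n (suc m)))))

  x^n-1-homo : ∀ x n → ⟦ x A.^ n A.- A.1# ⟧ ≈ ⟦ x ⟧ ^ n - 1#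
  x^n-1-homo x n = trans (+-homo _ _) (+-cong (^-homo x n) (trans (-‿homo _) (-‿cong 1#-homo)))

-- Coefficient lists as a commutative ring.

record CoeffRing (K : Coeffs) : Set₁ where
  open Coeffs K
  field
    _≈_ : Rel C 0ℓ
    isCommutativeRing : IsCommutativeRing _≈_ _+c_ _*c_ -c_ 0c 1c
    IsZ⇒≈0 : ∀ {x} → IsZ x → x ≈ 0c
    ≈0⇒IsZ : ∀ {x} → x ≈ 0c → IsZ x

  commutativeRing : CommutativeRing 0ℓ 0ℓ
  commutativeRing = record { isCommutativeRing = isCommutativeRing }

module PolynomialRing (K : Coeffs) (S : CoeffRing K) where
  open Coeffs K using (C)
  open Poly K
  open CoeffRing S hiding (_≈_)
  open CommutativeRing commutativeRing hiding (zero)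
  open import Algebra.Properties.Ring ring using (-0#≈0#)
  open import Algebra.Properties.AbelianGroup +-abelianGroup using (x≈y⇒x∙y⁻¹≈ε)

  coeff : Pol → ℕ → C
  coeff [] i = 0#
  coeff (a ∷ p) zero = a
  coeff (a ∷ p) (suc i) = coeff p i

  infix 4 _≋_
  -- Missing coefficients are read as 0, so trailing zeros disappear, and the additive laws reduce
  -- to those of the coefficients. It implies `_≈P_`, the equality of the theorem.
  record _≋_ (p r : Pol) : Set where
    constructor coeffwise
    field at : ∀ i → coeff p i ≈ coeff r i
  open _≋_ public

  coeff-⊕ : ∀ p r i → coeff (p ⊕ r) i ≈ coeff p i + coeff r i
  coeff-⊕ [] r i = sym (+-identityˡ _)
  coeff-⊕ (a ∷ p) [] i = sym (+-identityʳ _)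
  coeff-⊕ (a ∷ p) (b ∷ r) zero = refl
  coeff-⊕ (a ∷ p) (b ∷ r) (suc i) = coeff-⊕ p r i

  coeff-scale : ∀ a p i → coeff (scale a p) i ≈ a * coeff p i
  coeff-scale a [] i = sym (zeroʳ a)
  coeff-scale a (b ∷ p) zero = refl
  coeff-scale a (b ∷ p) (suc i) = coeff-scale a p i

  coeff-⊖ : ∀ p i → coeff (⊖ p) i ≈ - coeff p i
  coeff-⊖ [] i = sym -0#≈0#
  coeff-⊖ (b ∷ p) zero = refl
  coeff-⊖ (b ∷ p) (suc i) = coeff-⊖ p i

  IsZeroP⇒≋[] : ∀ p → IsZeroP p → p ≋ []
  IsZeroP⇒≋[] p z = coeffwise (go p z)
    where
    go : ∀ p → IsZeroP p → ∀ i → coeff p i ≈ 0#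
    go [] _ i = refl
    go (a ∷ p) (a0 , _) zero = IsZ⇒≈0 a0
    go (a ∷ p) (_ , p0) (suc i) = go p p0 i

  ≋[]⇒IsZeroP : ∀ p → p ≋ [] → IsZeroP p
  ≋[]⇒IsZeroP [] _ = tt
  ≋[]⇒IsZeroP (a ∷ p) e = ≈0⇒IsZ (at e 0) , ≋[]⇒IsZeroP p (coeffwise (λ i → at e (suc i)))

  ≋⇒≈P : ∀ {p r} → p ≋ r → p ≈P r
  ≋⇒≈P {p} {r} e = ≋[]⇒IsZeroP (p ⊕ (⊖ r)) (coeffwise λ i →
    trans (trans (coeff-⊕ p (⊖ r) i) (+-congˡ (coeff-⊖ r i))) (x≈y⇒x∙y⁻¹≈ε (at e i)))

  ≋-refl : ∀ {p} → p ≋ p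
  ≋-refl = coeffwise λ i → refl

  ≋-sym : ∀ {p r} → p ≋ r → r ≋ p
  ≋-sym e = coeffwise λ i → sym (at e i)

  ≋-trans : ∀ {p r s} → p ≋ r → r ≋ s → p ≋ s
  ≋-trans e f = coeffwise λ i → trans (at e i) (at f i)

  ≋-setoid : Setoid 0ℓ 0ℓ
  ≋-setoid = record { _≈_ = _≋_ ; isEquivalence = record { refl = ≋-refl ; sym = ≋-sym ; trans = ≋-trans } }

  ∷-cong : ∀ {a b p r} → a ≈ b → p ≋ r → a ∷ p ≋ b ∷ r
  ∷-cong a≈b p≋r = coeffwise λ { zero → a≈b ; (suc i) → at p≋r i }

  0∷[] : 0# ∷ [] ≋ []
  0∷[] = coeffwise λ { zero → refl ; (suc i) → refl }

  ⊕-cong : ∀ {p p′ r r′} → p ≋ p′ → r ≋ r′ → p ⊕ r ≋ p′ ⊕ r′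
  ⊕-cong {p} {p′} {r} {r′} e f = coeffwise λ i →
    trans (coeff-⊕ p r i) (trans (+-cong (at e i) (at f i)) (sym (coeff-⊕ p′ r′ i)))

  ⊕-assoc : ∀ p r s → (p ⊕ r) ⊕ s ≋ p ⊕ (r ⊕ s)
  ⊕-assoc p r s = coeffwise λ i →
    trans (trans (coeff-⊕ (p ⊕ r) s i) (+-congʳ (coeff-⊕ p r i))) (trans (+-assoc _ _ _)
      (sym (trans (coeff-⊕ p (r ⊕ s) i) (+-congˡ (coeff-⊕ r s i)))))

  ⊕-comm : ∀ p r → p ⊕ r ≋ r ⊕ p
  ⊕-comm p r = coeffwise λ i → trans (coeff-⊕ p r i) (trans (+-comm _ _) (sym (coeff-⊕ r p i)))

  ⊕-identityʳ : ∀ p → p ⊕ [] ≋ p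
  ⊕-identityʳ p = ⊕-comm p []

  ⊖-cong : ∀ {p r} → p ≋ r → ⊖ p ≋ ⊖ r
  ⊖-cong {p} {r} e = coeffwise λ i → trans (coeff-⊖ p i) (trans (-‿cong (at e i)) (sym (coeff-⊖ r i)))

  ⊕-inverseʳ : ∀ p → p ⊕ (⊖ p) ≋ []
  ⊕-inverseʳ p = coeffwise λ i → trans (coeff-⊕ p (⊖ p) i) (trans (+-congˡ (coeff-⊖ p i)) (-‿inverseʳ _))

  ⊕-abelianGroup : AbelianGroup 0ℓ 0ℓ
  ⊕-abelianGroup = record
    { _≈_ = _≋_ ; _∙_ = _⊕_ ; ε = [] ; _⁻¹ = ⊖_
    ; isAbelianGroup = record
      { isGroup = record
        { isMonoid = record
          { isSemigroup = record
            { isMagma = record { isEquivalence = Setoid.isEquivalence ≋-setoid ; ∙-cong = ⊕-cong }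
            ; assoc = ⊕-assoc }
          ; identity = (λ p → ≋-refl) , ⊕-identityʳ }
        ; inverse = (λ p → ≋-trans (⊕-comm (⊖ p) p) (⊕-inverseʳ p)) , ⊕-inverseʳ
        ; ⁻¹-cong = ⊖-cong }
      ; comm = ⊕-comm } }

  open import Algebra.Properties.CommutativeSemigroup (AbelianGroup.commutativeSemigroup ⊕-abelianGroup)
    using (interchange; x∙yz≈y∙xz)

  scale-cong : ∀ {a b p r} → a ≈ b → p ≋ r → scale a p ≋ scale b r
  scale-cong {a} {b} {p} {r} a≈b e = coeffwise λ i →
    trans (coeff-scale a p i) (trans (*-cong a≈b (at e i)) (sym (coeff-scale b r i)))

  scale-⊕ : ∀ a p r → scale a (p ⊕ r) ≋ scale a p ⊕ scale a r
  scale-⊕ a p r = coeffwise λ i → trans (coeff-scale a (p ⊕ r) i)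
    (trans (*-congˡ (coeff-⊕ p r i)) (trans (distribˡ a _ _)
      (sym (trans (coeff-⊕ (scale a p) (scale a r) i) (+-cong (coeff-scale a p i) (coeff-scale a r i))))))

  scale-scale : ∀ a b p → scale a (scale b p) ≋ scale (a * b) p
  scale-scale a b p = coeffwise λ i → trans (coeff-scale a (scale b p) i)
    (trans (*-congˡ (coeff-scale b p i)) (trans (sym (*-assoc a b _)) (sym (coeff-scale (a * b) p i))))

  scale-1 : ∀ p → scale 1# p ≋ p
  scale-1 p = coeffwise λ i → trans (coeff-scale 1# p i) (*-identityˡ _)

  scale-0 : ∀ p → scale 0# p ≋ []
  scale-0 p = coeffwise λ i → trans (coeff-scale 0# p i) (zeroˡ _)

  0∷-⊕ : ∀ p r → 0# ∷ (p ⊕ r) ≋ (0# ∷ p) ⊕ (0# ∷ r)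
  0∷-⊕ p r = ∷-cong (sym (+-identityˡ 0#)) ≋-refl

  ⊗-zeroʳ : ∀ p → p ⊗ [] ≋ []
  ⊗-zeroʳ [] = ≋-refl
  ⊗-zeroʳ (a ∷ p) = ≋-trans (∷-cong refl (⊗-zeroʳ p)) 0∷[]

  ⊗-congˡ : ∀ p {r r′} → r ≋ r′ → p ⊗ r ≋ p ⊗ r′
  ⊗-congˡ [] e = ≋-refl
  ⊗-congˡ (a ∷ p) e = ⊕-cong (scale-cong refl e) (∷-cong refl (⊗-congˡ p e))

  -- `_⊗_` recurses on its left factor. This is the expansion along the right one, from which
  -- commutativity follows, and then the right-hand laws from the left-hand ones.
  ⊗-∷ : ∀ p b r → p ⊗ (b ∷ r) ≋ scale b p ⊕ (0# ∷ (p ⊗ r))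
  ⊗-∷ [] b r = ≋-sym 0∷[]
  ⊗-∷ (a ∷ p) b r = ∷-cong (+-congʳ (*-comm a b))
    (≋-trans (⊕-cong ≋-refl (⊗-∷ p b r)) (x∙yz≈y∙xz (scale a r) (scale b p) (0# ∷ (p ⊗ r))))

  ⊗-comm : ∀ p r → p ⊗ r ≋ r ⊗ p
  ⊗-comm [] r = ≋-sym (⊗-zeroʳ r)
  ⊗-comm (a ∷ p) r = ≋-trans (⊕-cong ≋-refl (∷-cong refl (⊗-comm p r))) (≋-sym (⊗-∷ r a p))

  ⊗-cong : ∀ {p p′ r r′} → p ≋ p′ → r ≋ r′ → p ⊗ r ≋ p′ ⊗ r′
  ⊗-cong {p} {p′} {r} {r′} e f = ≋-trans (⊗-congˡ p f)
    (≋-trans (⊗-comm p r′) (≋-trans (⊗-congˡ r′ e) (⊗-comm r′ p′)))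

  ⊗-distribˡ-⊕ : ∀ p r s → p ⊗ (r ⊕ s) ≋ (p ⊗ r) ⊕ (p ⊗ s)
  ⊗-distribˡ-⊕ [] r s = ≋-refl
  ⊗-distribˡ-⊕ (a ∷ p) r s = ≋-trans
    (⊕-cong (scale-⊕ a r s) (≋-trans (∷-cong refl (⊗-distribˡ-⊕ p r s)) (0∷-⊕ (p ⊗ r) (p ⊗ s))))
    (interchange (scale a r) (scale a s) (0# ∷ (p ⊗ r)) (0# ∷ (p ⊗ s)))

  ⊗-distribʳ-⊕ : ∀ p r s → (r ⊕ s) ⊗ p ≋ (r ⊗ p) ⊕ (s ⊗ p)
  ⊗-distribʳ-⊕ p r s = ≋-trans (⊗-comm (r ⊕ s) p)
    (≋-trans (⊗-distribˡ-⊕ p r s) (⊕-cong (⊗-comm p r) (⊗-comm p s)))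

  scale-⊗ : ∀ a p r → scale a p ⊗ r ≋ scale a (p ⊗ r)
  scale-⊗ a [] r = ≋-refl
  scale-⊗ a (b ∷ p) r = ≋-trans
    (⊕-cong (≋-sym (scale-scale a b r)) (∷-cong (sym (zeroʳ a)) (scale-⊗ a p r)))
    (≋-sym (scale-⊕ a (scale b r) (0# ∷ (p ⊗ r))))

  0∷-⊗ : ∀ p r → (0# ∷ p) ⊗ r ≋ 0# ∷ (p ⊗ r)
  0∷-⊗ p r = ⊕-cong (scale-0 r) ≋-refl

  ⊗-assoc : ∀ p r s → (p ⊗ r) ⊗ s ≋ p ⊗ (r ⊗ s)
  ⊗-assoc [] r s = ≋-refl
  ⊗-assoc (a ∷ p) r s = ≋-trans (⊗-distribʳ-⊕ s (scale a r) (0# ∷ (p ⊗ r)))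
    (⊕-cong (scale-⊗ a r s) (≋-trans (0∷-⊗ (p ⊗ r) s) (∷-cong refl (⊗-assoc p r s))))

  const-⊗ : ∀ a p → const a ⊗ p ≋ scale a p
  const-⊗ a p = ≋-trans (⊕-cong ≋-refl 0∷[]) (⊕-identityʳ (scale a p))

  ⊗-identityˡ : ∀ p → one ⊗ p ≋ p
  ⊗-identityˡ p = ≋-trans (const-⊗ 1# p) (scale-1 p)

  -- The result is again a `CoeffRing`, so the construction iterates: from ℤ to ℤ[ζ], and from there
  -- to ℤ[ζ][q].
  polynomialCoeffRing : CoeffRing PolCoeffs
  polynomialCoeffRing = record
    { _≈_ = _≋_
    ; isCommutativeRing = record
      { isRing = record
        { +-isAbelianGroup = AbelianGroup.isAbelianGroup ⊕-abelianGroup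
        ; *-cong = ⊗-cong
        ; *-assoc = ⊗-assoc
        ; *-identity = ⊗-identityˡ , λ p → ≋-trans (⊗-comm p one) (⊗-identityˡ p)
        ; distrib = ⊗-distribˡ-⊕ , ⊗-distribʳ-⊕
        }
      ; *-comm = ⊗-comm
      }
    ; IsZ⇒≈0 = λ {p} → IsZeroP⇒≋[] p
    ; ≈0⇒IsZ = λ {p} → ≋[]⇒IsZeroP p
    }

ℤCoeffRing : CoeffRing ℤCoeffs
ℤCoeffRing = record
  { isCommutativeRing = ℤₚ.+-*-isCommutativeRing
  ; IsZ⇒≈0 = λ e → e
  ; ≈0⇒IsZ = λ e → e
  }

module ZRing = PolynomialRing ℤCoeffs ℤCoeffRing
module BRing = PolynomialRing ℤζCoeffs ZRing.polynomialCoeffRing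

ℤ[t] : CommutativeRing 0ℓ 0ℓ
ℤ[t] = CoeffRing.commutativeRing ZRing.polynomialCoeffRing

ℤ[ζ][q] : CommutativeRing 0ℓ 0ℓ
ℤ[ζ][q] = CoeffRing.commutativeRing BRing.polynomialCoeffRing

-- Division by monic polynomials in ℤ[t].

module MonicDivision where
  -- This and `longDivision` replicate the private loop of `divMonic`. Lists start with the highest
  -- degree, and `gs` is the divisor without its leading 1.
  subtractMultiple : ℤ → List ℤ → List ℤ → List ℤ
  subtractMultiple a [] r = r
  subtractMultiple a (g ∷ gs) [] = ℤ.- (a ℤ.* g) ∷ subtractMultiple a gs []
  subtractMultiple a (g ∷ gs) (x ∷ r) = (x ℤ.- a ℤ.* g) ∷ subtractMultiple a gs r

  longDivision : ℕ → List ℤ → List ℤ → List ℤ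
  longDivision zero r gs = []
  longDivision (suc f) [] gs = []
  longDivision (suc f) (a ∷ r) gs = a ∷ longDivision f (subtractMultiple a gs r) gs

  IsLongDivision : (ℕ → List ℤ → List ℤ → List ℤ) → Set
  IsLongDivision D = ∀ f r gs → D f r gs ≡ longDivision f r gs

  -- Stated for arbitrary `D` and `S`, so that it also applies to functions that cannot be named but
  -- whose defining equations hold by `refl`.
  longDivision-unique : (D : ℕ → List ℤ → List ℤ → List ℤ) (S : ℤ → List ℤ → List ℤ → List ℤ) →
    (∀ f a r gs → D (suc f) (a ∷ r) gs ≡ a ∷ D f (S a gs r) gs) →
    (∀ r gs → D zero r gs ≡ []) →
    (∀ f gs → D (suc f) [] gs ≡ []) →
    (∀ a r → S a [] r ≡ r) →
    (∀ a g gs → S a (g ∷ gs) [] ≡ ℤ.- (a ℤ.* g) ∷ S a gs []) →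
    (∀ a g gs x r → S a (g ∷ gs) (x ∷ r) ≡ (x ℤ.- a ℤ.* g) ∷ S a gs r) →
    IsLongDivision D
  longDivision-unique D S D-∷ D-0 D-[] S-[] S-∷-[] S-∷-∷ = D≡
    where
    S≡ : ∀ a gs r → S a gs r ≡ subtractMultiple a gs r
    S≡ a [] r = S-[] a r
    S≡ a (g ∷ gs) [] = ≡.trans (S-∷-[] a g gs) (≡.cong (ℤ.- (a ℤ.* g) ∷_) (S≡ a gs []))
    S≡ a (g ∷ gs) (x ∷ r) = ≡.trans (S-∷-∷ a g gs x r) (≡.cong ((x ℤ.- a ℤ.* g) ∷_) (S≡ a gs r))

    D≡ : IsLongDivision D
    D≡ zero r gs = D-0 r gs
    D≡ (suc f) [] gs = D-[] f gs
    D≡ (suc f) (a ∷ r) gs = ≡.trans (D-∷ f a r gs)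
      (≡.cong (a ∷_) (≡.trans (≡.cong (λ r → D f r gs) (S≡ a gs r)) (D≡ f (subtractMultiple a gs r) gs)))

  -- The division loop of `divMonic` is private: the hole in the next type is filled by unification in
  -- `divMonic-longDivision`, where abstracting over `reverse` makes this a pattern unification problem.
  hidden-longDivision : IsLongDivision _

  divMonic-longDivision : ∀ p g {x gs} → reverse g ≡ x ∷ gs →
    divMonic p g ≡ reverse (longDivision (suc (length p ∸ length g)) (reverse p) gs)
  divMonic-longDivision p g e with reverse g
  divMonic-longDivision p g ≡.refl | _ ∷ gs with suc (length p ∸ length g) | reverse p
  ... | f | r with reverse {A = ℤ}
  ... | ρ = ≡.cong ρ (hidden-longDivision f r gs)

  hidden-longDivision = longDivision-unique _ _ (λ f a r gs → ≡.refl) (λ r gs → ≡.refl) (λ f gs → ≡.refl)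
                          (λ a r → ≡.refl) (λ a g gs → ≡.refl) (λ a g gs x r → ≡.refl)

  open CommutativeRing ℤ[t] hiding (zero)
  open CommutativeRingSolver ℤ[t]
  open Exp commutativeSemiring using (_^_; ^-homo-*)
  open import Algebra.Properties.Semigroup.Divisibility *-semigroup using (_∣_; _,_)
  open Z using (X; const; Pol)
  open ZRing using (coeff; coeffwise; at; ∷-cong; 0∷[]; coeff-⊕; coeff-scale; ⊗-∷; 0∷-⊗; ⊗-identityˡ; const-⊗)
  open import Relation.Binary.Reasoning.Setoid setoid

  X* : ∀ p → X * p ≈ + 0 ∷ p
  X* p = trans (0∷-⊗ Z.one p) (∷-cong ≡.refl (⊗-identityˡ p))

  ++-split : ∀ l p → l ++ p ≈ l + X ^ length l * p
  ++-split [] p = sym (*-identityˡ p)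
  ++-split (a ∷ l) p = begin
    a ∷ (l ++ p)                             ≈⟨ ∷-cong (≡.sym (ℤₚ.+-identityʳ a)) (++-split l p) ⟩
    (a ∷ l) + (+ 0 ∷ X ^ length l * p)       ≈⟨ +-congˡ {a ∷ l} (X* (X ^ length l * p)) ⟨
    (a ∷ l) + X * (X ^ length l * p)         ≈⟨ +-congˡ {a ∷ l} (*-assoc X (X ^ length l) p) ⟨
    (a ∷ l) + X ^ length (a ∷ l) * p         ∎

  reverse-∷ : ∀ a r → reverse (a ∷ r) ≈ reverse r + X ^ length r * const a
  reverse-∷ a r = begin
    reverse (a ∷ r)                                       ≡⟨ Listₚ.unfold-reverse a r ⟩
    reverse r ∷ʳ a                                        ≈⟨ ++-split (reverse r) (const a) ⟩
    reverse r + X ^ length (reverse r) * const a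
      ≡⟨ ≡.cong (λ k → reverse r + X ^ k * const a) (Listₚ.length-reverse r) ⟩
    reverse r + X ^ length r * const a                    ∎

  const-sub : ∀ x a g → const (x ℤ.- a ℤ.* g) ≈ const x - const a * const g
  const-sub x a g = coeffwise λ
    { zero → ≡.cong (λ y → x ℤ.- y) (≡.sym (ℤₚ.+-identityʳ (a ℤ.* g)))
    ; (suc i) → ≡.refl }

  length-subtractMultiple : ∀ f a gs r → length r ≡ f ℕ.+ length gs →
    length (subtractMultiple a gs r) ≡ length r
  length-subtractMultiple f a [] r _ = ≡.refl
  length-subtractMultiple f a (g ∷ gs) [] e = contradiction (≡.trans e (ℕₚ.+-suc f (length gs))) λ ()
  length-subtractMultiple f a (g ∷ gs) (x ∷ r) e =
    ≡.cong suc (length-subtractMultiple f a gs r (ℕₚ.suc-injective (≡.trans e (ℕₚ.+-suc f (length gs)))))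

  -- Highest-first lists are aligned at their heads, so `gs` sits `f` places above the low end of
  -- `r`; this is the factor `X ^ f`.
  reverse-subtractMultiple : ∀ f a gs r → length r ≡ f ℕ.+ length gs →
    reverse (subtractMultiple a gs r) ≈ reverse r - const a * X ^ f * reverse gs
  reverse-subtractMultiple f a [] r _ = sym (trans (+-congˡ {reverse r} (-‿cong (zeroʳ (const a * X ^ f)))) (+-identityʳ _))
  reverse-subtractMultiple f a (g ∷ gs) [] e = contradiction (≡.trans e (ℕₚ.+-suc f (length gs))) λ ()
  reverse-subtractMultiple f a (g ∷ gs) (x ∷ r) e = begin
    reverse ((x ℤ.- a ℤ.* g) ∷ s)
      ≈⟨ reverse-∷ (x ℤ.- a ℤ.* g) s ⟩
    reverse s + X ^ length s * const (x ℤ.- a ℤ.* g)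
      ≡⟨ ≡.cong (λ k → reverse s + X ^ k * const (x ℤ.- a ℤ.* g)) (length-subtractMultiple f a gs r e′) ⟩
    reverse s + X ^ length r * const (x ℤ.- a ℤ.* g)
      ≈⟨ +-cong (reverse-subtractMultiple f a gs r e′) (*-congˡ {X ^ length r} (const-sub x a g)) ⟩
    (reverse r - const a * X ^ f * reverse gs) + X ^ length r * (const x - const a * const g)
      ≈⟨ solve 7 (λ R A F S L x g → (R :- A :* F :* S) :+ L :* (x :- A :* g) :=
           ((R :+ L :* x) :- A :* F :* S) :- L :* (A :* g)) refl
           (reverse r) (const a) (X ^ f) (reverse gs) (X ^ length r) (const x) (const g) ⟩
    ((reverse r + X ^ length r * const x) - const a * X ^ f * reverse gs) - X ^ length r * (const a * const g)
      ≈⟨ +-congˡ (-‿cong (*-congʳ (trans (reflexive (≡.cong (X ^_) e′)) (^-homo-* X f (length gs))))) ⟩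
    ((reverse r + X ^ length r * const x) - const a * X ^ f * reverse gs) - (X ^ f * X ^ length gs) * (const a * const g)
      ≈⟨ solve 6 (λ R A F S G g → (R :- A :* F :* S) :- (F :* G) :* (A :* g) := R :- A :* F :* (S :+ G :* g)) refl
           (reverse r + X ^ length r * const x) (const a) (X ^ f) (reverse gs) (X ^ length gs) (const g) ⟩
    (reverse r + X ^ length r * const x) - const a * X ^ f * (reverse gs + X ^ length gs * const g)
      ≈⟨ +-cong (reverse-∷ x r) (-‿cong (*-congˡ {const a * X ^ f} (reverse-∷ g gs))) ⟨
    reverse (x ∷ r) - const a * X ^ f * reverse (g ∷ gs) ∎
    where
    s = subtractMultiple a gs r
    e′ : length r ≡ f ℕ.+ length gs
    e′ = ℕₚ.suc-injective (≡.trans e (ℕₚ.+-suc f (length gs)))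

  length-longDivision : ∀ f r gs → length r ≡ f ℕ.+ length gs → length (longDivision f r gs) ≡ f
  length-longDivision zero r gs e = ≡.refl
  length-longDivision (suc f) (a ∷ r) gs e = ≡.cong suc (length-longDivision f (subtractMultiple a gs r) gs
    (≡.trans (length-subtractMultiple f a gs r (ℕₚ.suc-injective e)) (ℕₚ.suc-injective e)))

  -- Each round cancels the head `a` by subtracting a X^f times the divisor: its top term removes
  -- `a`, and its lower part is the work of `subtractMultiple`. After `f` rounds only `length gs`
  -- coefficients remain.
  longDivision-correct : ∀ f r gs → length r ≡ f ℕ.+ length gs → ∃ λ rem → length rem ≡ length gs ×
    reverse r ≈ reverse (longDivision f r gs) * (reverse gs + X ^ length gs) + rem
  longDivision-correct zero r gs e = reverse r , ≡.trans (Listₚ.length-reverse r) e , refl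
  longDivision-correct (suc f) (a ∷ r) gs e
    with rem , |rem| , eq ← longDivision-correct f (subtractMultiple a gs r) gs
           (≡.trans (length-subtractMultiple f a gs r (ℕₚ.suc-injective e)) (ℕₚ.suc-injective e))
    = rem , |rem| , (begin
      reverse (a ∷ r)
        ≈⟨ reverse-∷ a r ⟩
      reverse r + X ^ length r * const a
        ≈⟨ +-congˡ (*-congʳ (trans (reflexive (≡.cong (X ^_) (ℕₚ.suc-injective e))) (^-homo-* X f (length gs)))) ⟩
      reverse r + (X ^ f * X ^ length gs) * const a
        ≈⟨ solve 5 (λ R F L A S → R :+ (F :* L) :* A := (R :- A :* F :* S) :+ (F :* A) :* (S :+ L)) refl
             (reverse r) (X ^ f) (X ^ length gs) (const a) (reverse gs) ⟩
      (reverse r - const a * X ^ f * reverse gs) + (X ^ f * const a) * g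
        ≈⟨ +-congʳ (reverse-subtractMultiple f a gs r (ℕₚ.suc-injective e)) ⟨
      reverse r′ + (X ^ f * const a) * g
        ≈⟨ +-congʳ eq ⟩
      (reverse Q * g + rem) + (X ^ f * const a) * g
        ≈⟨ solve 4 (λ Q g R F → (Q :* g :+ R) :+ F :* g := (Q :+ F) :* g :+ R) refl
             (reverse Q) g rem (X ^ f * const a) ⟩
      (reverse Q + X ^ f * const a) * g + rem
        ≡⟨ ≡.cong (λ k → (reverse Q + X ^ k * const a) * g + rem) (≡.sym |Q|) ⟩
      (reverse Q + X ^ length Q * const a) * g + rem
        ≈⟨ +-congʳ (*-congʳ (reverse-∷ a Q)) ⟨
      reverse (a ∷ Q) * g + rem ∎)
    where
    g = reverse gs + X ^ length gs
    r′ = subtractMultiple a gs r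
    Q = longDivision f r′ gs
    |Q| : length Q ≡ f
    |Q| = length-longDivision f r′ gs
            (≡.trans (length-subtractMultiple f a gs r (ℕₚ.suc-injective e)) (ℕₚ.suc-injective e))

  -- A condition on the list itself and not on its class: `divMonic` takes the last entry for the
  -- leading coefficient, and a trailing zero would mislead it.
  record Monic (g : Pol) : Set where
    constructor monic
    field
      {lower} : Pol
      shape : g ≡ lower ∷ʳ + 1

    degree : ℕ
    degree = length lower

  open Monic using (degree)

  DegreeBelow : ℕ → Pol → Set
  DegreeBelow n p = ∀ i → n ≤ i → coeff p i ≡ + 0

  degreeBelow-length : ∀ p {n} → length p ≤ n → DegreeBelow n p
  degreeBelow-length [] _ i _ = ≡.refl
  degreeBelow-length (a ∷ p) (s≤s p≤n) (suc i) (s≤s n≤i) = degreeBelow-length p p≤n i n≤i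

  degreeBelow-0 : ∀ {p} → DegreeBelow 0 p → p ≈ 0#
  degreeBelow-0 d = coeffwise λ i → d i z≤n

  coeff-∷ʳ : ∀ (l : Pol) a → coeff (l ∷ʳ a) (length l) ≡ a
  coeff-∷ʳ [] a = ≡.refl
  coeff-∷ʳ (_ ∷ l) a = coeff-∷ʳ l a

  monic-coeff : ∀ {g} (m : Monic g) → coeff g (degree m) ≡ + 1
  monic-coeff (monic {l} ≡.refl) = coeff-∷ʳ l (+ 1)

  monic-length : ∀ {g} (m : Monic g) → length g ≡ suc (degree m)
  monic-length (monic {l} ≡.refl) = ≡.trans (Listₚ.length-++ l) (ℕₚ.+-comm (length l) 1)

  monic-degreeBelow : ∀ {g} (m : Monic g) → DegreeBelow (suc (degree m)) g
  monic-degreeBelow {g} m = degreeBelow-length g (ℕₚ.≤-reflexive (monic-length m))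

  -- Induction on the list `u`: above the degree of `g`, the coefficients of g (b ∷ u) are those of
  -- g u moved up by one. For k = 0 this first makes the tail zero, and then the coefficient at
  -- `degree m` is `b` itself.
  monic-degree-* : ∀ {g} (m : Monic g) u k → DegreeBelow (degree m ℕ.+ k) (g * u) → DegreeBelow k u
  monic-degree-* m [] k _ i _ = ≡.refl
  monic-degree-* {g} m (b ∷ u) k d = go k d
    where
    coeff-g* : ∀ i → coeff (g * (b ∷ u)) i ≡ b ℤ.* coeff g i ℤ.+ coeff (+ 0 ∷ (g * u)) i
    coeff-g* i = ≡.trans (at (⊗-∷ g b u) i)
      (≡.trans (coeff-⊕ (Z.scale b g) _ i) (≡.cong (ℤ._+ _) (coeff-scale b g i)))
    tail : ∀ k → DegreeBelow (degree m ℕ.+ suc k) (g * (b ∷ u)) → DegreeBelow k u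
    tail k d = monic-degree-* m u k λ i D+k≤i →
      let D+1+k≤1+i = ≡.subst (_≤ suc i) (≡.sym (ℕₚ.+-suc (degree m) k)) (s≤s D+k≤i)
      in ≡.trans (≡.sym (≡.trans (coeff-g* (suc i))
           (≡.trans (≡.cong (λ x → b ℤ.* x ℤ.+ coeff (g * u) i) (monic-degreeBelow m (suc i) (s≤s (ℕₚ.m+n≤o⇒m≤o _ D+k≤i))))
             (≡.trans (≡.cong (ℤ._+ coeff (g * u) i) (ℤₚ.*-zeroʳ b)) (ℤₚ.+-identityˡ _)))))
         (d (suc i) D+1+k≤1+i)
    go : ∀ k → DegreeBelow (degree m ℕ.+ k) (g * (b ∷ u)) → DegreeBelow k (b ∷ u)
    go (suc k) d (suc i) (s≤s k≤i) = tail k d i k≤i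
    go zero d (suc i) _ = u≡0 i z≤n
      where
      u≡0 : DegreeBelow 0 u
      u≡0 = tail 0 λ i le → d i (ℕₚ.≤-trans (ℕₚ.+-monoʳ-≤ (degree m) z≤n) le)
    go zero d zero _ = ≡.trans (≡.sym leading) (d (degree m) (ℕₚ.≤-reflexive (ℕₚ.+-identityʳ _)))
      where
      u≈0 : u ≈ 0#
      u≈0 = degreeBelow-0 (tail 0 λ i le → d i (ℕₚ.≤-trans (ℕₚ.+-monoʳ-≤ (degree m) z≤n) le))
      leading : coeff (g * (b ∷ u)) (degree m) ≡ b
      leading = ≡.trans (coeff-g* (degree m))
        (≡.trans (≡.cong₂ (λ x y → b ℤ.* x ℤ.+ y) (monic-coeff m)
                   (at (trans (∷-cong ≡.refl (trans (*-congˡ {g} u≈0) (zeroʳ g))) 0∷[]) (degree m)))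
          (≡.trans (ℤₚ.+-identityʳ _) (ℤₚ.*-identityʳ b)))

  monic-nonZeroDivisor : ∀ {g} → Monic g → ∀ u → g * u ≈ 0# → u ≈ 0#
  monic-nonZeroDivisor m u e = degreeBelow-0 (monic-degree-* m u 0 λ i _ → at e i)

  monic-cancelˡ : ∀ {g} → Monic g → ∀ u v → g * u ≈ g * v → u ≈ v
  monic-cancelˡ {g} m u v e = begin
    u             ≈⟨ solve 2 (λ u v → u := (u :- v) :+ v) refl u v ⟩
    (u - v) + v   ≈⟨ +-congʳ (monic-nonZeroDivisor m (u - v) difference≈0) ⟩
    0# + v        ≈⟨ +-identityˡ v ⟩
    v             ∎
    where
    difference≈0 : g * (u - v) ≈ 0#
    difference≈0 = trans (solve 3 (λ g u v → g :* (u :- v) := g :* u :- g :* v) refl g u v)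
      (trans (+-congʳ { - (g * v)} e) (-‿inverseʳ (g * v)))

  monic-∣-small : ∀ {g} (m : Monic g) {w} → g ∣ w → DegreeBelow (degree m) w → w ≈ 0#
  monic-∣-small {g} m {w} (u , e) d = trans (sym e) (trans (*-comm u g) (trans (*-congˡ {g} u≈0) (zeroʳ g)))
    where
    u≈0 : u ≈ 0#
    u≈0 = degreeBelow-0 (monic-degree-* m u 0 λ i le →
      ≡.trans (at (trans (*-comm g u) e) i) (d i (ℕₚ.m+n≤o⇒m≤o _ le)))

  monic-reverse : ∀ {g} (m : Monic g) → reverse g ≡ + 1 ∷ reverse (Monic.lower m)
  monic-reverse (monic {l} ≡.refl) = Listₚ.reverse-++ l (+ 1 ∷ [])

  monic-split : ∀ {g} (m : Monic g) → let gs = reverse (Monic.lower m) in reverse gs + X ^ length gs ≈ g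
  monic-split (monic {l} ≡.refl) = begin
    reverse (reverse l) + X ^ length (reverse l)
      ≡⟨ ≡.cong₂ (λ p k → p + X ^ k) (Listₚ.reverse-involutive l) (Listₚ.length-reverse l) ⟩
    l + X ^ length l                               ≈⟨ +-congˡ {l} (*-identityʳ (X ^ length l)) ⟨
    l + X ^ length l * const (+ 1)                 ≈⟨ ++-split l (const (+ 1)) ⟨
    l ∷ʳ + 1                                       ∎

  longDivision-monic : ∀ {g} (m : Monic g) f p → length p ≡ f ℕ.+ degree m →
    ∃ λ rem → DegreeBelow (degree m) rem ×
      p ≈ reverse (longDivision f (reverse p) (reverse (Monic.lower m))) * g + rem
  longDivision-monic {g} m f p e
    with rem , |rem| , eq ← longDivision-correct f (reverse p) (reverse (Monic.lower m))
           (≡.trans (Listₚ.length-reverse p) (≡.trans e (≡.cong (f ℕ.+_) (≡.sym (Listₚ.length-reverse (Monic.lower m))))))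
    = rem , degreeBelow-length rem (ℕₚ.≤-reflexive (≡.trans |rem| (Listₚ.length-reverse (Monic.lower m)))) ,
      trans (reflexive (≡.sym (Listₚ.reverse-involutive p))) (trans eq (+-congʳ {rem}
        (*-congˡ {reverse (longDivision f (reverse p) (reverse (Monic.lower m)))} (monic-split m))))

  monic-divMod : ∀ {g} (m : Monic g) p → ∃₂ λ s rem → DegreeBelow (degree m) rem × p ≈ s * g + rem
  monic-divMod m p with degree m ℕₚ.≤? length p
  ... | yes D≤p with rem , d , e ← longDivision-monic m (length p ∸ degree m) p (≡.sym (ℕₚ.m∸n+n≡m D≤p)) =
    reverse (longDivision (length p ∸ degree m) (reverse p) (reverse (Monic.lower m))) , rem , d , e
  ... | no D≰p = 0# , p , degreeBelow-length p (ℕₚ.<⇒≤ (ℕₚ.≰⇒> D≰p)) , refl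

  -- Divide `f` by `g` with remainder. Then n + 1 times the remainder is a multiple of `g` of too
  -- small a degree, hence zero, and ℤ has no torsion.
  const-regular : ∀ {g} → Monic g → ∀ n f → g ∣ const (+ suc n) * f → g ∣ f
  const-regular {g} m n f (w , e) with s , rem , d , f≈ ← monic-divMod m f =
    s , trans (sym (+-identityʳ (s * g))) (trans (+-congˡ {s * g} (sym rem≈0)) (sym f≈))
    where
    c = const (+ suc n)
    coeff-c* : ∀ i → coeff (c * rem) i ≡ + suc n ℤ.* coeff rem i
    coeff-c* i = ≡.trans (at (const-⊗ (+ suc n) rem) i) (coeff-scale (+ suc n) rem i)
    c*rem≈0 : c * rem ≈ 0#
    c*rem≈0 = monic-∣-small m (w - c * s , (begin
        (w - c * s) * g               ≈⟨ solve 4 (λ w c s g → (w :- c :* s) :* g := w :* g :- c :* (s :* g)) refl w c s g ⟩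
        w * g - c * (s * g)           ≈⟨ +-congʳ { - (c * (s * g))} (trans e (*-congˡ {c} f≈)) ⟩
        c * (s * g + rem) - c * (s * g)  ≈⟨ solve 3 (λ c s r → c :* (s :+ r) :- c :* s := c :* r) refl c (s * g) rem ⟩
        c * rem                       ∎))
      λ i le → ≡.trans (coeff-c* i) (≡.trans (≡.cong (+ suc n ℤ.*_) (d i le)) (ℤₚ.*-zeroʳ (+ suc n)))
    rem≈0 : rem ≈ 0#
    rem≈0 = coeffwise λ i → ℤₚ.*-cancelˡ-≡ (+ suc n) (coeff rem i) (+ 0)
      (≡.trans (≡.sym (coeff-c* i)) (≡.trans (at c*rem≈0 i) (≡.sym (ℤₚ.*-zeroʳ (+ suc n)))))

-- Divisibility properties of the recursively defined cyclotomic polynomials.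

module CyclotomicPolynomials where
  open MonicDivision
  open CommutativeRing ℤ[t] hiding (zero)
  open CommutativeRingSolver ℤ[t]
  open Exp commutativeSemiring using (_^_; ^-homo-*; ^-assocʳ)
  open import Algebra.Properties.Semiring.Mult semiring using () renaming (_×_ to _·_)
  open import Algebra.Properties.Semigroup.Divisibility *-semigroup
    using (_∣_; _,_; ∣ʳ-respʳ-≈; ∣ʳ-respˡ-≈; ∣ʳ-trans; x∣ʳy⇒x∣ʳzy)
  open import Algebra.Properties.CommutativeSemigroup.Divisibility *-commutativeSemigroup
    using (x∣y∧z∣x/y⇒xz∣y; x∣xy)
  open Z using (X; const; Pol; prodP)
  open ZRing using (coeffwise; at)
  open FixedElements ℤ[t] using (geometric; geometric-telescope)
  open import Relation.Binary.Reasoning.Setoid setoid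

  -- An equality of lists, as `Monic` demands; since `p` is no longer than `l`, the final 1 stays
  -- untouched.
  monic-⊕ : ∀ p l → length p ≤ length l → ∃ λ l′ → length l′ ≡ length l × p Z.⊕ (l ∷ʳ + 1) ≡ l′ ∷ʳ + 1
  monic-⊕ [] l _ = l , ≡.refl , ≡.refl
  monic-⊕ (a ∷ p) (b ∷ l) (s≤s p≤l) with l′ , |l′| , e ← monic-⊕ p l p≤l =
    (a ℤ.+ b) ∷ l′ , ≡.cong suc |l′| , ≡.cong ((a ℤ.+ b) ∷_) e

  scale-1-⊕ : ∀ b p → Z.scale (+ 1) (b ∷ p) Z.⊕ (+ 0 ∷ []) ≡ b ∷ p
  scale-1-⊕ b p = ≡.cong₂ _∷_ (≡.trans (ℤₚ.+-identityʳ _) (ℤₚ.*-identityˡ b)) (⊕[] (Z.scale (+ 1) p) (scale-1 p))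
    where
    scale-1 : ∀ p → Z.scale (+ 1) p ≡ p
    scale-1 p = ≡.trans (Listₚ.map-cong ℤₚ.*-identityˡ p) (Listₚ.map-id p)
    ⊕[] : ∀ p {r} → p ≡ r → p Z.⊕ [] ≡ r
    ⊕[] [] e = e
    ⊕[] (_ ∷ _) e = e

  monic-1⊗ : ∀ l → Z.one Z.⊗ (l ∷ʳ + 1) ≡ l ∷ʳ + 1
  monic-1⊗ [] = ≡.refl
  monic-1⊗ (b ∷ l) = scale-1-⊕ b (l ∷ʳ + 1)

  monic-⊗ : ∀ l r → ∃ λ l′ → length l′ ≡ length l ℕ.+ length r × (l ∷ʳ + 1) Z.⊗ (r ∷ʳ + 1) ≡ l′ ∷ʳ + 1
  monic-⊗ [] r = r , ≡.refl , monic-1⊗ r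
  monic-⊗ (a ∷ l) r with l′ , |l′| , e ← monic-⊗ l r
    with l″ , |l″| , e′ ← monic-⊕ (Z.scale a (r ∷ʳ + 1)) (+ 0 ∷ l′) (ℕₚ.≤-trans (ℕₚ.≤-reflexive
           (≡.trans (Listₚ.length-map (a ℤ.*_) (r ∷ʳ + 1)) (≡.trans (Listₚ.length-++ r) (ℕₚ.+-comm (length r) 1))))
           (s≤s (ℕₚ.≤-trans (ℕₚ.m≤n+m (length r) (length l)) (ℕₚ.≤-reflexive (≡.sym |l′|))))) =
    l″ , ≡.trans |l″| (≡.cong suc |l′|) , ≡.trans (≡.cong (λ p → Z.scale a (r ∷ʳ + 1) Z.⊕ (+ 0 ∷ p)) e) e′

  monic-* : ∀ {p r} → Monic p → Monic r → Monic (p * r)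
  monic-* (monic {l} ≡.refl) (monic {r} ≡.refl) with _ , _ , e ← monic-⊗ l r = monic e

  monic-1 : Monic 1#
  monic-1 = monic {lower = []} ≡.refl

  monic-X^ : ∀ n → ∃ λ l → X ^ n ≡ l ∷ʳ + 1 × length l ≡ n
  monic-X^ zero = [] , ≡.refl , ≡.refl
  monic-X^ (suc n) with l , e , |l| ← monic-X^ n with l′ , |l′| , e′ ← monic-⊗ (+ 0 ∷ []) l =
    l′ , ≡.trans (≡.cong (X Z.⊗_) e) e′ , ≡.trans |l′| (≡.cong suc |l|)

  monic-X^-1 : ∀ {n} → 1 ≤ n → Monic (X ^ n - 1#)
  monic-X^-1 {suc n} _ with a ∷ l , e , _ ← monic-X^ (suc n) =
    monic {lower = (a ℤ.+ ℤ.- + 1) ∷ l} (≡.trans (≡.cong (Z._⊕ (ℤ.- + 1 ∷ [])) e) (≡.cong ((a ℤ.+ ℤ.- + 1) ∷_) (⊕[] l)))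
    where
    ⊕[] : ∀ l → (l ∷ʳ + 1) Z.⊕ [] ≡ l ∷ʳ + 1
    ⊕[] [] = ≡.refl
    ⊕[] (_ ∷ _) = ≡.refl

  monic-∣⇒degree≤ : ∀ {g p} (m : Monic g) (n : Monic p) → g ∣ p → Monic.degree m ≤ Monic.degree n
  monic-∣⇒degree≤ m n g∣p with Monic.degree m ℕₚ.≤? Monic.degree n
  ... | yes le = le
  ... | no ≰ = contradiction (≡.trans (≡.sym (monic-coeff n)) (at p≈0 (Monic.degree n))) λ ()
    where
    p≈0 = monic-∣-small m g∣p λ i le → monic-degreeBelow n i (ℕₚ.≤-trans (ℕₚ.≰⇒> ≰) le)

  -- With p = u g given and p = s g + rem found by long division, rem = (u - s) g is a multiple of
  -- `g` of smaller degree, hence zero. The first quotient coefficient is the leading 1 of `p`,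
  -- which makes `s` monic.
  divMonic-exact : ∀ {p g} → Monic p → Monic g → g ∣ p → Monic (divMonic p g) × divMonic p g * g ≈ p
  divMonic-exact {p} {g} n m g∣p@(u , ug≈p) = ≡.subst Good (≡.sym (divMonic-longDivision p g (monic-reverse m)))
    (monicQuotient , exact)
    where
    Good : Pol → Set
    Good s = Monic s × s * g ≈ p
    f = length p ∸ length g
    quotientList = longDivision (suc f) (reverse p) (reverse (Monic.lower m))
    s = reverse quotientList
    gs = reverse (Monic.lower m)
    rest = longDivision f (subtractMultiple (+ 1) gs (reverse (Monic.lower n))) gs
    monicQuotient : Monic s
    monicQuotient = monic {lower = reverse rest} (≡.trans
      (≡.cong (λ r → reverse (longDivision (suc f) r gs)) (monic-reverse n))
      (Listₚ.unfold-reverse (+ 1) rest))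
    |p| : length p ≡ suc f ℕ.+ Monic.degree m
    |p| = ≡.trans (≡.sym (ℕₚ.m∸n+n≡m
        (≡.subst₂ _≤_ (≡.sym (monic-length m)) (≡.sym (monic-length n)) (s≤s (monic-∣⇒degree≤ m n g∣p)))))
      (≡.trans (≡.cong (f ℕ.+_) (monic-length m)) (ℕₚ.+-suc f (Monic.degree m)))
    exact : s * g ≈ p
    exact with rem , d , e ← longDivision-monic m (suc f) p |p| =
      sym (trans e (trans (+-congˡ {s * g} rem≈0) (+-identityʳ (s * g))))
      where
      rem≈0 : rem ≈ 0#
      rem≈0 = monic-∣-small m (u - s , (begin
        (u - s) * g            ≈⟨ solve 3 (λ u s g → (u :- s) :* g := u :* g :- s :* g) refl u s g ⟩
        u * g - s * g          ≈⟨ +-congʳ { - (s * g)} (trans ug≈p e) ⟩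
        (s * g + rem) - s * g  ≈⟨ solve 2 (λ x r → (x :+ r) :- x := r) refl (s * g) rem ⟩
        rem                    ∎)) d

  ^P≡^ : ∀ p n → p Z.^P n ≡ p ^ n
  ^P≡^ p zero = ≡.refl
  ^P≡^ p (suc n) = ≡.cong (p Z.⊗_) (^P≡^ p n)

  tPowMinus1≡ : ∀ n → tPowMinus1 n ≡ X ^ n - 1#
  tPowMinus1≡ n = ≡.cong (_- 1#) (^P≡^ X n)

  ∈-properDivisors⁻ : ∀ {d N} → d ∈ properDivisors N → 1 ≤ d × d < N × d ∣ℕ N
  ∈-properDivisors⁻ {d} {suc n} d∈ with d∈′ , d∣N ← ∈-filter⁻ (_∣? suc n) {xs = applyUpTo suc n} d∈
    with i , i<n , ≡.refl ← ∈-applyUpTo⁻ suc d∈′ = s≤s z≤n , s≤s i<n , d∣N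

  ∈-properDivisors⁺ : ∀ {d N} → 1 ≤ d → d < N → d ∣ℕ N → d ∈ properDivisors N
  ∈-properDivisors⁺ {suc d} {suc n} _ (s≤s d<n) d∣N = ∈-filter⁺ (_∣? suc n) (∈-applyUpTo⁺ suc d<n) d∣N

  properDivisors-increasing : ∀ N → AllPairs _<_ (properDivisors N)
  properDivisors-increasing zero = []
  properDivisors-increasing (suc n) =
    AllPairsₚ.filter⁺ (_∣? suc n) (AllPairsₚ.applyUpTo⁺₁ suc n (λ i<j _ → s≤s i<j))

  -- `Φ N` evaluates every `Φ d` inside it with fuel N - 1 instead of d. Proper divisors are smaller
  -- than N, so either amount suffices.
  cycF-fuel : ∀ f f′ {N} → 1 ≤ N → N ≤ f → N ≤ f′ → cycF f N ≡ cycF f′ N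
  cycF-fuel zero _ (s≤s _) ()
  cycF-fuel (suc f) zero (s≤s _) _ ()
  cycF-fuel (suc f) (suc f′) {N} _ N≤f N≤f′ = ≡.cong (λ l → divMonic (tPowMinus1 N) (prodP l))
    (Listₚ.map-cong-local (All.tabulate λ d∈ → let 1≤d , d<N , _ = ∈-properDivisors⁻ {N = N} d∈ in
      cycF-fuel f f′ 1≤d (ℕₚ.≤-pred (ℕₚ.≤-trans d<N N≤f)) (ℕₚ.≤-pred (ℕₚ.≤-trans d<N N≤f′))))

  Ψ : ℕ → Pol
  Ψ N = prodP (map Φ (properDivisors N))

  Φ-divMonic : ∀ {N} → 1 ≤ N → Φ N ≡ divMonic (X ^ N - 1#) (Ψ N)
  Φ-divMonic {suc n} _ = ≡.cong₂ divMonic (tPowMinus1≡ (suc n)) (≡.cong prodP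
    (Listₚ.map-cong-local (All.tabulate λ {d} d∈ → let 1≤d , d<N , _ = ∈-properDivisors⁻ {N = suc n} d∈ in
      cycF-fuel n d 1≤d (ℕₚ.≤-pred d<N) ℕₚ.≤-refl)))

  X^d-1∣X^N-1 : ∀ {d N} → d ∣ℕ N → X ^ d - 1# ∣ X ^ N - 1#
  X^d-1∣X^N-1 {d} (ℕ∣.divides k ≡.refl) = geometric k (X ^ d) , trans (*-comm (geometric k (X ^ d)) (X ^ d - 1#))
    (trans (geometric-telescope k (X ^ d))
      (+-congʳ { - 1#} (trans (^-assocʳ X d k) (reflexive (≡.cong (X ^_) (ℕₚ.*-comm d k))))))

  -- This cancellation property plays the part of coprimality. It makes products of distinct Φ_d
  -- divide (`prodΦ-∣`), and it removes the unwanted factor in `Φ∣gauss` and in `Φ₂∣X^c+1`.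
  Regular : ℕ → Set
  Regular N = ∀ m → 1 ≤ m → m < N → ∀ f → Φ N ∣ (X ^ m - 1#) * f → Φ N ∣ f

  record Cyclotomic (N : ℕ) : Set where
    field
      Φ-monic : Monic (Φ N)
      Φ*Ψ : Φ N * Ψ N ≈ X ^ N - 1#
      Φ-regular : Regular N

    Φ∣X^N-1 : Φ N ∣ X ^ N - 1#
    Φ∣X^N-1 = Ψ N , trans (*-comm (Ψ N) (Φ N)) Φ*Ψ

  open Cyclotomic

  -- Split off the smallest index: F = G Φ_d. For a later e, Φ_e divides Ψ_d F = (X^d - 1) G, and
  -- regularity of Φ_e at d < e gives Φ_e ∣ G. The increasing order guarantees d < e.
  prodΦ-∣ : ∀ l F → AllPairs _<_ l → All (1 ≤_) l → All Cyclotomic l → All (λ d → Φ d ∣ F) l → prodP (map Φ l) ∣ F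
  prodΦ-∣ [] F _ _ _ _ = F , *-identityʳ F
  prodΦ-∣ (d ∷ l) F (d< ∷ incr) (1≤d ∷ 1≤l) (cyc ∷ cycs) ((G , GΦ≈F) ∷ Φ∣F) =
    x∣y∧z∣x/y⇒xz∣y (G , GΦ≈F) (prodΦ-∣ l G incr 1≤l cycs (All.zipWith cancelΦd (d< , All.zip (cycs , Φ∣F))))
    where
    cancelΦd : ∀ {e} → d < e × Cyclotomic e × Φ e ∣ F → Φ e ∣ G
    cancelΦd {e} (d<e , cyc-e , Φe∣F) = Φ-regular cyc-e d 1≤d d<e G (∣ʳ-respʳ-≈ (begin
      Ψ d * F               ≈⟨ *-congˡ {Ψ d} GΦ≈F ⟨
      Ψ d * (G * Φ d)       ≈⟨ solve 3 (λ p g f → p :* (g :* f) := (f :* p) :* g) refl (Ψ d) G (Φ d) ⟩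
      (Φ d * Ψ d) * G       ≈⟨ *-congʳ {G} (Φ*Ψ cyc) ⟩
      (X ^ d - 1#) * G      ∎) (x∣ʳy⇒x∣ʳzy (Ψ d) Φe∣F))

  prodP-∷ʳ : ∀ l p → prodP (l ∷ʳ p) ≈ prodP l * p
  prodP-∷ʳ [] p = *-comm p 1#
  prodP-∷ʳ (x ∷ l) p = trans (*-congˡ {x} (prodP-∷ʳ l p)) (sym (*-assoc x (prodP l) p))

  prodP-monic : ∀ l → All Monic l → Monic (prodP l)
  prodP-monic [] [] = monic-1
  prodP-monic (p ∷ l) (m ∷ ms) = monic-* m (prodP-monic l ms)

  ∈⇒∣prodP : ∀ {p l} → p ∈ l → p ∣ prodP l
  ∈⇒∣prodP {p} {x ∷ l} (here ≡.refl) = x∣xy p (prodP l)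
  ∈⇒∣prodP {l = x ∷ l} (there p∈) = x∣ʳy⇒x∣ʳzy x (∈⇒∣prodP p∈)

  ·1≈const : ∀ k → k · 1# ≈ const (+ k)
  ·1≈const zero = coeffwise λ { zero → ≡.refl ; (suc i) → ≡.refl }
  ·1≈const (suc k) = trans (+-congˡ {1#} (·1≈const k)) (coeffwise λ { zero → ≡.refl ; (suc i) → ≡.refl })

  module _ {N : ℕ} (1≤N : 1 ≤ N) (smaller : ∀ {d} → d < N → 1 ≤ d → Cyclotomic d) where

    private
      below : ∀ {d} → d ∈ properDivisors N → Cyclotomic d
      below d∈ with 1≤d , d<N , _ ← ∈-properDivisors⁻ {N = N} d∈ = smaller d<N 1≤d

    Ψ∣X^N-1 : Ψ N ∣ X ^ N - 1#
    Ψ∣X^N-1 = prodΦ-∣ (properDivisors N) (X ^ N - 1#) (properDivisors-increasing N)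
      (All.tabulate λ d∈ → proj₁ (∈-properDivisors⁻ {N = N} d∈))
      (All.tabulate below)
      (All.tabulate λ d∈ → ∣ʳ-trans (Φ∣X^N-1 (below d∈)) (X^d-1∣X^N-1 (proj₂ (proj₂ (∈-properDivisors⁻ {N = N} d∈)))))

    Ψ-monic : Monic (Ψ N)
    Ψ-monic = prodP-monic (map Φ (properDivisors N)) (Allₚ.map⁺ (All.tabulate λ d∈ → Φ-monic (below d∈)))

    Φ-quotient : Monic (Φ N) × Φ N * Ψ N ≈ X ^ N - 1#
    Φ-quotient = ≡.subst (λ p → Monic p × p * Ψ N ≈ X ^ N - 1#) (≡.sym (Φ-divMonic 1≤N))
      (divMonic-exact (monic-X^-1 1≤N) Ψ-monic Ψ∣X^N-1)

    -- X^g - 1 is the product of Φ_d over all divisors d of g, with g itself included. Each such d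
    -- is a proper divisor of N, so its Φ_d is one of the factors of Ψ_N.
    X^g-1∣Ψ : ∀ {g} → 1 ≤ g → g < N → g ∣ℕ N → X ^ g - 1# ∣ Ψ N
    X^g-1∣Ψ {g} 1≤g g<N g∣N = ∣ʳ-respˡ-≈ product (prodΦ-∣ divisors (Ψ N)
      (AllPairsₚ.++⁺ (properDivisors-increasing g) ([] ∷ [])
        (All.tabulate λ d∈ → proj₁ (proj₂ (∈-properDivisors⁻ {N = g} d∈)) ∷ []))
      (All.tabulate λ d∈ → proj₁ (divisor d∈))
      (All.tabulate λ d∈ → let 1≤d , d≤g , _ = divisor d∈ in smaller (ℕₚ.≤-<-trans d≤g g<N) 1≤d)
      (All.tabulate λ d∈ → let 1≤d , d≤g , d∣g = divisor d∈ in
        ∈⇒∣prodP (∈-map⁺ Φ (∈-properDivisors⁺ 1≤d (ℕₚ.≤-<-trans d≤g g<N) (ℕ∣.∣-trans d∣g g∣N)))))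
      where
      divisors = properDivisors g ∷ʳ g
      divisor : ∀ {d} → d ∈ divisors → 1 ≤ d × d ≤ g × d ∣ℕ g
      divisor d∈ with ∈-++⁻ (properDivisors g) d∈
      ... | inj₁ d∈′ = let 1≤d , d<g , d∣g = ∈-properDivisors⁻ {N = g} d∈′ in 1≤d , ℕₚ.<⇒≤ d<g , d∣g
      ... | inj₂ (here ≡.refl) = 1≤g , ℕₚ.≤-refl , ℕ∣.∣-refl
      product : prodP (map Φ divisors) ≈ X ^ g - 1#
      product = begin
        prodP (map Φ divisors)                     ≡⟨ ≡.cong prodP (Listₚ.map-++ Φ (properDivisors g) (g ∷ [])) ⟩
        prodP (map Φ (properDivisors g) ∷ʳ Φ g)    ≈⟨ prodP-∷ʳ (map Φ (properDivisors g)) (Φ g) ⟩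
        Ψ g * Φ g                                  ≈⟨ *-comm (Ψ g) (Φ g) ⟩
        Φ g * Ψ g                                  ≈⟨ Φ*Ψ (smaller g<N 1≤g) ⟩
        X ^ g - 1#                                 ∎

    -- X^N - 1 is both Φ_N Ψ_N and (X^g - 1) times the geometric sum. As X^g - 1 divides Ψ_N and is
    -- monic, it cancels.
    Φ∣geometric : ∀ {g} k → N ≡ k ℕ.* g → 1 ≤ g → g < N → Φ N ∣ geometric k (X ^ g)
    Φ∣geometric {g} k N≡kg 1≤g g<N with W , W*≈Ψ ← X^g-1∣Ψ 1≤g g<N (ℕ∣.divides k N≡kg) =
      W , monic-cancelˡ (monic-X^-1 1≤g) (W * Φ N) (geometric k (X ^ g)) (begin
        (X ^ g - 1#) * (W * Φ N)           ≈⟨ solve 3 (λ x w p → x :* (w :* p) := p :* (w :* x)) refl (X ^ g - 1#) W (Φ N) ⟩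
        Φ N * (W * (X ^ g - 1#))           ≈⟨ *-congˡ {Φ N} W*≈Ψ ⟩
        Φ N * Ψ N                          ≈⟨ proj₂ Φ-quotient ⟩
        X ^ N - 1#                         ≡⟨ ≡.cong (λ n → X ^ n - 1#) (≡.trans N≡kg (ℕₚ.*-comm k g)) ⟩
        X ^ (g ℕ.* k) - 1#                 ≈⟨ +-congʳ { - 1#} (^-assocʳ X g k) ⟨
        (X ^ g) ^ k - 1#                   ≈⟨ geometric-telescope k (X ^ g) ⟨
        (X ^ g - 1#) * geometric k (X ^ g) ∎)

    -- If X^m fixes f modulo Φ_N, so does X^g for g = gcd(m, N); hence the geometric sum over N/g powers
    -- of X^g, which Φ_N divides, acts on f as the integer N/g, which is regular modulo a monic polynomial.
    regular : Regular N
    regular m 1≤m m<N f Φ∣ = clear k N≡kg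
      where
      g = gcd m N
      open QuotientRing ℤ[t] (Φ N) using (quotientRing; congruent; ∣⇒≈0; ≈0⇒∣; ≈⇒≈ₚ; _≈ₚ_)
      open QuotientOperations ℤ[t] (Φ N) using (^-quotient; ·-quotient; geometric-quotient)
      module Q = CommutativeRing quotientRing
      module QF = FixedElements quotientRing
      Fixes : Pol → Set
      Fixes x = x * f ≈ₚ f
      fixed : ∀ n → Φ N ∣ (X ^ n - 1#) * f → Fixes (X ^ n)
      fixed n d = congruent (∣ʳ-respʳ-≈ (solve 2 (λ x f → (x :- :1) :* f := x :* f :- f) refl (X ^ n) f) d)
      fixed-g : Fixes (X ^ g)
      fixed-g = ≡.subst Fixes (^-quotient X g) (QF.fixed-gcd {X} {f} m N
        (≡.subst Fixes (≡.sym (^-quotient X m)) (fixed m Φ∣))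
        (≡.subst Fixes (≡.sym (^-quotient X N)) (fixed N (∣ʳ-respʳ-≈ (*-comm f (X ^ N - 1#))
          (x∣ʳy⇒x∣ʳzy f (Ψ N , trans (*-comm (Ψ N) (Φ N)) (proj₂ Φ-quotient)))))))
      1≤g : 1 ≤ g
      1≤g = ℕₚ.n≢0⇒n>0 λ g≡0 → ℕₚ.<⇒≢ 1≤m (≡.sym (gcd[m,n]≡0⇒m≡0 g≡0))
      g<N : g < N
      g<N = ℕₚ.≤-<-trans (ℕ∣.∣⇒≤ {{>-nonZero 1≤m}} (gcd[m,n]∣m m N)) m<N
      k = ℕ∣.quotient (gcd[m,n]∣n m N)
      N≡kg : N ≡ k ℕ.* g
      N≡kg = ℕ∣.m∣n⇒n≡quotient*m (gcd[m,n]∣n m N)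
      clear : ∀ k → N ≡ k ℕ.* g → Φ N ∣ f
      clear zero N≡0 = contradiction N≡0 λ e → ℕₚ.<⇒≢ 1≤N (≡.sym e)
      clear (suc k) N≡kg = const-regular (proj₁ Φ-quotient) k f (≈0⇒∣ (Q.trans
        (≈⇒≈ₚ (*-congʳ {f} (sym (·1≈const (suc k)))))
        (Q.trans (Q.sym (≡.subst₂ (λ x y → x * f ≈ₚ y * f) (geometric-quotient (suc k) (X ^ g))
                   (·-quotient (suc k) 1#)
                   (QF.geometric-fixed (suc k) {X ^ g} {f} fixed-g)))
          (Q.trans (Q.*-congʳ {f} (∣⇒≈0 (Φ∣geometric (suc k) N≡kg 1≤g g<N))) (Q.zeroˡ f)))))

  cyclotomic : ∀ {N} → 1 ≤ N → Cyclotomic N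
  cyclotomic {N} = <-rec (λ N → 1 ≤ N → Cyclotomic N) step N
    where
    step : ∀ N → (∀ {d} → d < N → 1 ≤ d → Cyclotomic d) → 1 ≤ N → Cyclotomic N
    step N smaller 1≤N = record
      { Φ-monic = proj₁ (Φ-quotient 1≤N smaller)
      ; Φ*Ψ = proj₂ (Φ-quotient 1≤N smaller)
      ; Φ-regular = regular 1≤N smaller
      }

  -- By absorption, (X^m - 1) [N, m] = (X^N - 1) [N-1, m-1] is a multiple of Φ_N, and regularity
  -- cancels X^m - 1.
  Φ∣gauss : ∀ {N} m → 1 ≤ m → m < N → Φ N ∣ GaussianBinomials.gauss ℤ[t] X N m
  Φ∣gauss {suc n} (suc m) 1≤m m<N = Φ-regular (cyclotomic (s≤s z≤n)) (suc m) 1≤m m<N (gauss (suc n) (suc m))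
    (∣ʳ-respʳ-≈ (sym (gauss-absorption n m)) (∣ʳ-respʳ-≈ (*-comm (gauss n m) (X ^ suc n - 1#))
      (x∣ʳy⇒x∣ʳzy (gauss n m) (Φ∣X^N-1 (cyclotomic {suc n} (s≤s z≤n))))))
    where open GaussianBinomials ℤ[t] X

  -- Regularity at c < 2c cancels the first factor of X^(2c) - 1 = (X^c - 1) (X^c + 1). This yields
  -- ζ^c = -1.
  Φ₂∣X^c+1 : ∀ {c} → 1 ≤ c → Φ (2 ℕ.* c) ∣ X ^ c + 1#
  Φ₂∣X^c+1 {c} 1≤c = Φ-regular cyc c 1≤c c<2c (X ^ c + 1#) (∣ʳ-respʳ-≈ (begin
    X ^ (2 ℕ.* c) - 1#
      ≈⟨ +-congʳ { - 1#} (trans (reflexive (≡.cong (λ k → X ^ (c ℕ.+ k)) (ℕₚ.+-identityʳ c))) (^-homo-* X c c)) ⟩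
    X ^ c * X ^ c - 1#
      ≈⟨ solve 1 (λ x → x :* x :- :1 := (x :- :1) :* (x :+ :1)) refl (X ^ c) ⟩
    (X ^ c - 1#) * (X ^ c + 1#)     ∎) (Φ∣X^N-1 cyc))
    where
    c<2c : c < 2 ℕ.* c
    c<2c = ℕₚ.m<m+n c (ℕₚ.≤-trans 1≤c (ℕₚ.m≤m+n c 0))
    cyc : Cyclotomic (2 ℕ.* c)
    cyc = cyclotomic (ℕₚ.≤-trans 1≤c (ℕₚ.<⇒≤ c<2c))

open CyclotomicPolynomials

-- The embeddings of ℤ[q] and ℤ[ζ] into ℤ[ζ][q].

module ℤt where
  open CommutativeRing ℤ[t] public
  open GaussianBinomials ℤ[t] Z.X public using (gauss)

qbinom≡gauss : ∀ n m → qbinom n m ≡ ℤt.gauss n m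
qbinom≡gauss n zero = ≡.refl
qbinom≡gauss zero (suc m) = ≡.refl
qbinom≡gauss (suc n) (suc m) = ≡.cong₂ Z._⊕_ (qbinom≡gauss n m)
  (≡.cong₂ Z._⊗_ (^P≡^ Z.X (suc m)) (qbinom≡gauss n (suc m)))

module Lifts where
  open CommutativeRing ℤ[ζ][q] hiding (zero)
  open BRing

  const-⊗-const : ∀ a b → B.const (a Z.⊗ b) ≈ B.const a * B.const b
  const-⊗-const a b = ≋-sym (const-⊗ a (B.const b))

  -- Past the end of the list `[]` meets `Z.const (+ 0)`, a list with one zero, so equality holds
  -- only in the sense of ℤ[t].
  coeff-liftQ : ∀ p i → coeff (liftQ p) i ℤt.≈ Z.const (ZRing.coeff p i)
  coeff-liftQ [] i = ℤt.sym ZRing.0∷[]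
  coeff-liftQ (a ∷ p) zero = ℤt.refl
  coeff-liftQ (a ∷ p) (suc i) = coeff-liftQ p i

  liftQ-cong : ∀ {p r} → p ℤt.≈ r → liftQ p ≈ liftQ r
  liftQ-cong {p} {r} e = coeffwise λ i → ℤt.trans (coeff-liftQ p i)
    (ℤt.trans (ℤt.reflexive (≡.cong Z.const (ZRing.at e i))) (ℤt.sym (coeff-liftQ r i)))

  liftQ-⊕ : ∀ p r → liftQ (p Z.⊕ r) ≡ liftQ p + liftQ r
  liftQ-⊕ [] r = ≡.refl
  liftQ-⊕ (a ∷ p) [] = ≡.refl
  liftQ-⊕ (a ∷ p) (b ∷ r) = ≡.cong (Z.const (a ℤ.+ b) ∷_) (liftQ-⊕ p r)

  liftQ-⊖ : ∀ p → liftQ (Z.⊖ p) ≡ - liftQ p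
  liftQ-⊖ [] = ≡.refl
  liftQ-⊖ (a ∷ p) = ≡.cong (Z.const (ℤ.- a) ∷_) (liftQ-⊖ p)

  liftQ-scale : ∀ a p → liftQ (Z.scale a p) ≈ B.scale (Z.const a) (liftQ p)
  liftQ-scale a [] = refl
  liftQ-scale a (b ∷ p) = ∷-cong (ℤt.sym (ZRing.const-⊗ a (Z.const b))) (liftQ-scale a p)

  liftQ-⊗ : ∀ p r → liftQ (p Z.⊗ r) ≈ liftQ p * liftQ r
  liftQ-⊗ [] r = refl
  liftQ-⊗ (a ∷ p) r = trans (reflexive (liftQ-⊕ (Z.scale a r) (+ 0 ∷ (p Z.⊗ r))))
    (⊕-cong (liftQ-scale a r) (∷-cong ZRing.0∷[] (liftQ-⊗ p r)))

-- The abstract result applied to ℤ[ζ][q] modulo Φ_{2c}(ζ).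

module Assembly (c-1 k-1 : ℕ) (k-odd : suc k-1 % 2 ≡ 1) where
  c = suc c-1
  k = suc k-1
  N = k ℕ.* c
  p = liftζ (Φ (2 ℕ.* c))

  open QuotientRing ℤ[ζ][q] p using (quotientRing; ∣⇒≈0; ≈⇒≈ₚ; residue)
  open CommutativeRing quotientRing hiding (zero)
  open Exp commutativeSemiring using (_^_; ^-assocʳ; ^-congʳ)
  open import Algebra.Properties.Group +-group using (inverseˡ-unique)
  open import Algebra.Properties.Semiring.Mult semiring using () renaming (_×_ to _·_)
  open import Algebra.Properties.Semigroup.Divisibility *-semigroup using (_∣_; _,_; ∣ʳ-respʳ-≈)
  open FiniteSums quotientRing using (Σ<-cong; foldr-applyUpTo)
  open Lifts
  open FixedElements quotientRing using (odd-power)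
  module Bq = CommutativeRing ℤ[ζ][q]
  module Bq∣ where
    open import Algebra.Properties.Semigroup.Divisibility Bq.*-semigroup public using (_∣_; _,_)

  q′ ζ′ φ′ : Carrier
  q′ = liftQ Z.X
  ζ′ = liftζ ζ
  φ′ = liftQ (Φ N)

  open GaussianBinomials quotientRing q′ using (gauss)

  liftζ-isHom : IsRingHomomorphism ℤt.rawRing rawRing liftζ
  liftζ-isHom = record
    { isSemiringHomomorphism = record
      { isNearSemiringHomomorphism = record
        { +-isMonoidHomomorphism = record
          { isMagmaHomomorphism = record
            { isRelHomomorphism = record { cong = λ e → ≈⇒≈ₚ (BRing.∷-cong e BRing.≋-refl) }
            ; homo = λ a b → refl }
          ; ε-homo = ≈⇒≈ₚ BRing.0∷[] }
        ; *-homo = λ a b → ≈⇒≈ₚ (const-⊗-const a b) }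
      ; 1#-homo = refl }
    ; -‿homo = λ a → refl
    }

  liftQ-isHom : IsRingHomomorphism ℤt.rawRing rawRing liftQ
  liftQ-isHom = record
    { isSemiringHomomorphism = record
      { isNearSemiringHomomorphism = record
        { +-isMonoidHomomorphism = record
          { isMagmaHomomorphism = record
            { isRelHomomorphism = record { cong = λ e → ≈⇒≈ₚ (liftQ-cong e) }
            ; homo = λ a b → reflexive (liftQ-⊕ a b) }
          ; ε-homo = refl }
        ; *-homo = λ a b → ≈⇒≈ₚ (liftQ-⊗ a b) }
      ; 1#-homo = refl }
    ; -‿homo = λ a → reflexive (liftQ-⊖ a)
    }

  module Hζ = Homomorphism ℤ[t] quotientRing liftζ liftζ-isHom
  module HQ = Homomorphism ℤ[t] quotientRing liftQ liftQ-isHom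

  φ′∣gauss : ∀ {j} → suc j < N → φ′ ∣ gauss N (suc j)
  φ′∣gauss {j} j<N = ∣ʳ-respʳ-≈ (HQ.gauss-homo Z.X N (suc j)) (HQ.∣-homo (Φ∣gauss (suc j) (s≤s z≤n) j<N))

  ζ′^c : ζ′ ^ c ≈ - 1#
  ζ′^c = inverseˡ-unique (ζ′ ^ c) 1# (trans (+-congʳ {1#} (sym (Hζ.^-homo ζ c)))
    (Hζ.kernel-∣ (Φ₂∣X^c+1 {c} (s≤s z≤n)) (∣⇒≈0 (Bq.1# Bq∣., Bq.*-identityˡ p))))

  setting : CyclotomicSetting quotientRing
  setting = record
    { q = q′
    ; ω = ζ′
    ; φ = φ′
    ; γ = liftQ (Ψ N)
    -- As `k` and `c` are successors, `N` computes to a successor, so `suc (ℕ.pred N)` is `N` by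
    -- computation.
    ; N-1 = ℕ.pred N
    ; qᴺ = trans (sym (HQ.*-homo (Φ N) (Ψ N)))
        (trans (HQ.⟦⟧-cong (Cyclotomic.Φ*Ψ (cyclotomic {N} (s≤s z≤n)))) (HQ.x^n-1-homo Z.X N))
    -- ζ^(kc) = (ζ^c)^k = (-1)^k, and k is odd.
    ; ωᴺ = trans (trans (^-congʳ ζ′ (ℕₚ.*-comm k c)) (sym (^-assocʳ ζ′ c k))) (odd-power ζ′^c k k-odd)
    ; φ∣gauss = λ j<N-1 → φ′∣gauss (s≤s j<N-1)
    }

  open Vanishing quotientRing setting

  value : B.Pol → Seq
  value P m = liftζ (evalAt P m)

  value-∷ : ∀ a P m → value (a ∷ P) m ≈ liftζ a + m · 1# * value P m
  value-∷ a P m = +-congˡ {liftζ a} (trans (Hζ.*-homo (Z.const (+ m)) (evalAt P m))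
    (*-congʳ {value P m} (trans (Hζ.⟦⟧-cong (ℤt.sym (·1≈const m))) (Hζ.·1-homo m))))

  -- Horner's rule costs one degree per entry, whereas `degBound` is the length minus one; the last
  -- entry is therefore treated as a constant.
  value-deg : ∀ P → Deg (degBound P) (value P)
  value-deg [] = resp (λ m → sym Hζ.0#-homo) (constant 0#)
  value-deg (a ∷ []) = resp (λ m → sym (trans (value-∷ a [] m)
    (trans (+-congˡ {liftζ a} (trans (*-congˡ {m · 1#} Hζ.0#-homo) (zeroʳ (m · 1#)))) (+-identityʳ (liftζ a)))))
    (constant (liftζ a))
  value-deg (a ∷ P@(_ ∷ P′)) = resp (λ m → sym (value-∷ a P m))
    (add (constant-deg (suc (length P′)) (liftζ a)) (mulVar (value-deg P)))

  module Sum (z : ℕ) (P : B.Pol) (n : ℕ) where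
    summand : ℕ → B.Pol
    summand m = liftζ ((ζ Z.^P m) Z.⊗ evalAt P m) B.⊗ liftQ ((Z.X Z.^P (z ℕ.* m)) Z.⊗ qbinom n m)

    weight : Seq
    weight m = (q′ ^ m) ^ z * value P m

    weight-deg : Deg (degBound P) weight
    weight-deg = expo^ z (value-deg P)

    summand≈ : ∀ j → summand j ≈ (ζ′ ^ j * value P j) * (q′ ^ (z ℕ.* j) * gauss n j)
    summand≈ j = *-cong
      (trans (Hζ.*-homo (ζ Z.^P j) (evalAt P j))
        (*-congʳ {value P j} (trans (reflexive (≡.cong liftζ (^P≡^ ζ j))) (Hζ.^-homo ζ j))))
      (trans (HQ.*-homo (Z.X Z.^P (z ℕ.* j)) (qbinom n j))
        (*-cong (trans (reflexive (≡.cong liftQ (^P≡^ Z.X (z ℕ.* j)))) (HQ.^-homo Z.X (z ℕ.* j)))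
                (trans (reflexive (≡.cong liftQ (qbinom≡gauss n j))) (HQ.gauss-homo Z.X n j))))

    theSum≈steps : theSum z P n ≈ steps n weight 0
    theSum≈steps = trans (reflexive (foldr-applyUpTo summand (λ j → j) (suc n)))
      (trans (Σ<-cong (suc n) (λ j _ → summand≈ j)) (sym (steps-weighted n z (value P))))

  ^P≡^ᴮ : ∀ x n → x B.^P n ≡ x ^ n
  ^P≡^ᴮ x zero = ≡.refl
  ^P≡^ᴮ x (suc n) = ≡.cong (x B.⊗_) (^P≡^ᴮ x n)

  congMod : ∀ {M S} w → S ≈ w * M → CongMod c M S zeroB
  congMod {M} {S} w e = w , proj₁ (residue w M e) ,
    BRing.≋⇒≈P (Bq.trans (BRing.⊕-identityʳ S) (proj₂ (residue w M e)))

  congruence : ∀ d z P n → (degBound P ℕ.+ 2 ℕ.* d ℕ.+ 1) ℕ.* k ℕ.* c ≤ n →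
    CongMod c (φ′ B.^P suc d) (theSum z P n) zeroB
  congruence d z P n bound = conclude (φ^∣steps M {e = suc d} exponent M*N≤n weight-deg 0)
    where
    open Sum z P n
    M = degBound P ℕ.+ 2 ℕ.* d ℕ.+ 1
    M*N≤n : M ℕ.* N ≤ n
    M*N≤n = ≡.subst (_≤ n) (ℕₚ.*-assoc M k c) bound
    -- An equality in fact: with e = d + 1, a + 2 e - 1 is exactly the number M of blocks that the
    -- hypothesis on n provides.
    exponent : degBound P ℕ.+ (suc d ℕ.+ suc d) ≤ suc M
    exponent = ℕₚ.≤-reflexive (rearrange (degBound P) d)
      where
      rearrange : ∀ a d → a ℕ.+ (suc d ℕ.+ suc d) ≡ suc (a ℕ.+ 2 ℕ.* d ℕ.+ 1)
      rearrange = solve-∀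
    conclude : φ′ ^ suc d ∣ steps n weight 0 → CongMod c (φ′ B.^P suc d) (theSum z P n) zeroB
    conclude (w , e) = congMod w (trans theSum≈steps (trans (sym e)
      (*-congˡ {w} (reflexive (≡.sym (^P≡^ᴮ φ′ (suc d)))))))

open import Data.Nat using (_+_; _*_)

theorem3p5 : (c k d z : ℕ) → 1 ≤ c → 1 ≤ k → k % 2 ≡ 1 →
    (P : B.Pol) → (n : ℕ) → (degBound P + 2 * d + 1) * k * c ≤ n →
    CongMod c (liftQ (Φ (k * c)) B.^P suc d) (theSum z P n) zeroB
theorem3p5 (suc c) (suc k) d z _ _ k-odd P n bound = Assembly.congruence c k k-odd d z P n bound
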